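{- For each positive integer $n$, let $a_n$ denote the number of unlabelled $n$-vertex word-representable graphs, i.e. the number of isomorphism classes of word-representable graphs on $n$ vertices. Then, as $n\to\infty$, $$a_n=2^{\frac{n^2}{3}+o(n^2)}.$$
   Context: Graphs are finite and simple. Distinct letters $x$ and $y$ alternate in a word $w$ if deleting all other letters from $w$ results in a word of the form $xyxy\cdots$ or $yxyx\cdots$ (of even or odd length). A graph $G=(V,E)$ is word-representable if there exists a finite word $w$ over the alphabet $V$, in which each letter of $V$ occurs at least once, such that for all distinct $x,y\in V$, the letters $x$ and $y$ alternate in $w$ if and only if $\{x,y\}\in E$. -}

module Defs where

open import Data.Bool.Base using (Bool; true; false; T)
open import Data.Bool.Properties using (T?) renaming (_≟_ to _≟ᵇ_)
open import Data.Fin.Base using (Fin; zero; suc; toℕ; finToFun; funToFin)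
open import Data.Fin.Patterns using (0F; 1F; 2F; 3F)
open import Data.Fin.Permutation as Perm using (Permutation′; permutation; _⟨$⟩ʳ_; _⟨$⟩ˡ_)
open import Data.Fin.Properties
  using (_≟_; any?; all?; pigeonhole; <-cmp; toℕ<n; finToFun-funToFin)
open import Data.List.Base using (List; []; _∷_; _++_; length; filter; take; drop)
open import Data.List.Membership.Propositional using (_∈_)
open import Data.List.Properties
  using (take++drop≡id; length-++; length-take; length-drop; ∷-injectiveˡ; ∷-injectiveʳ)
open import Data.List.Relation.Unary.Any using (here; there)
open import Data.Nat.Base
  using (ℕ; zero; suc; _+_; _*_; _^_; _∸_; _⊓_; _≤_; _<_; NonZero; z<s; s≤s; s≤s⁻¹)
open import Data.Nat.Induction using (<-wellFounded; Acc; acc)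
import Data.Nat.Properties as ℕ
open import Data.Product.Base using (Σ; ∃-syntax; ∃₂; _×_; _,_; proj₁; proj₂; uncurry)
open import Data.Sum.Base using (_⊎_; inj₁; inj₂)
open import Function.Base using (_∘_; _on_)
open import Function.Bundles using (Bijection; _⇔_; mk⇔; Equivalence)
open import Level using (0ℓ)
open import Relation.Binary.Bundles using (Setoid)
open import Relation.Binary.Definitions using (tri<; tri≈; tri>)
open import Relation.Binary.PropositionalEquality
  using (_≡_; _≢_; refl; sym; trans; cong; cong₂; subst; setoid; module ≡-Reasoning)
open import Relation.Nullary using (¬_; Dec; yes; no; contradiction)
open import Relation.Nullary.Decidable using (map′; _×-dec_; _⊎-dec_; _→-dec_; ¬?)

record Graph (n : ℕ) : Set where
  field
    adj        : Fin n → Fin n → Bool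
    adj-sym    : ∀ x y → adj x y ≡ adj y x
    adj-irrefl : ∀ x → adj x x ≡ false

open Graph public

Adjacent : ∀ {n} → Graph n → Fin n → Fin n → Set
Adjacent G x y = T (adj G x y)

infix 4 _≅_

_≅_ : ∀ {n} → Graph n → Graph n → Set
_≅_ {n} G H = Σ (Permutation′ n) λ π →
  ∀ x y → adj H (π ⟨$⟩ʳ x) (π ⟨$⟩ʳ y) ≡ adj G x y

≅-refl : ∀ {n} {G : Graph n} → G ≅ G
≅-refl = Perm.id , λ _ _ → refl

≅-sym : ∀ {n} {G H : Graph n} → G ≅ H → H ≅ G
≅-sym {H = H} (π , eq) = Perm.flip π , λ x y →
  trans (sym (eq _ _)) (cong₂ (adj H) (Perm.inverseʳ π) (Perm.inverseʳ π))

≅-trans : ∀ {n} {G H K : Graph n} → G ≅ H → H ≅ K → G ≅ K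
≅-trans (π , eq₁) (ρ , eq₂) = π Perm.∘ₚ ρ , λ x y → trans (eq₂ _ _) (eq₁ x y)

Word : ℕ → Set
Word n = List (Fin n)

-- The word x y x y ⋯ of length k.
alternating : ∀ {A : Set} → A → A → ℕ → List A
alternating x y zero    = []
alternating x y (suc k) = x ∷ alternating y x k

restrict : ∀ {n} → Fin n → Fin n → Word n → Word n
restrict x y = filter λ z → (z ≟ x) ⊎-dec (z ≟ y)

Alternate : ∀ {n} → Fin n → Fin n → Word n → Set
Alternate x y w =
  ∃[ k ] (restrict x y w ≡ alternating x y k ⊎ restrict x y w ≡ alternating y x k)

Represents : ∀ {n} → Word n → Graph n → Set
Represents w G =
  (∀ x → x ∈ w) × (∀ x y → x ≢ y → Alternate x y w ⇔ Adjacent G x y)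

WordRepresentable : ∀ {n} → Graph n → Set
WordRepresentable G = ∃[ w ] Represents w G

-- Setoid equality is isomorphism, so the elements up to equality are the
-- isomorphism classes.
WordRepresentableGraphs : ℕ → Setoid 0ℓ 0ℓ
WordRepresentableGraphs n = record
  { Carrier       = Σ (Graph n) WordRepresentable
  ; _≈_           = _≅_ on proj₁
  ; isEquivalence = record
    { refl  = λ {G} → ≅-refl {G = proj₁ G}
    ; sym   = λ {G} {H} → ≅-sym {G = proj₁ G} {proj₁ H}
    ; trans = λ {G} {H} {K} → ≅-trans {G = proj₁ G} {proj₁ H} {proj₁ K}
    }
  }

HasCardinality : Setoid 0ℓ 0ℓ → ℕ → Set
HasCardinality S a = Bijection (setoid (Fin a)) S

-- a n = 2 ^ (f n / d + o(g n)).  For every rational ε = p / q > 0,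
-- eventually
--   2 ^ (f n / d - ε * g n) ≤ a n ≤ 2 ^ (f n / d + ε * g n);
-- raising everything to the power d * q and clearing the negative
-- exponent leaves natural numbers only.
_≐2^[_/_+o_] : (ℕ → ℕ) → (ℕ → ℕ) → (d : ℕ) .{{_ : NonZero d}} → (ℕ → ℕ) → Set
a ≐2^[ f / d +o g ] =
  ∀ (p q : ℕ) .{{_ : NonZero p}} .{{_ : NonZero q}} →
  ∃[ N ] ∀ n → N ≤ n →
    2 ^ (q * f n) ≤ a n ^ (d * q) * 2 ^ (d * p * g n)
  × a n ^ (d * q) ≤ 2 ^ (q * f n + d * p * g n)

-- Word-representability is decidable.  For each pair x, y, read a word
-- from the right by the automaton with states
--   0: neither letter seen,  1: alternating, starts with x,
--   3: not alternating,      2: alternating, starts with y.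
-- The states for all pairs decide which graph a word represents; there
-- are finitely many of them, so short words suffice.

module _ {n : ℕ} where

  readˣ readʸ : Fin 4 → Fin 4
  readˣ 0F = 1F
  readˣ 1F = 3F
  readˣ 2F = 1F
  readˣ 3F = 3F
  readʸ 0F = 2F
  readʸ 1F = 2F
  readʸ 2F = 3F
  readʸ 3F = 3F

  step : Fin n → Fin n → Fin n → Fin 4 → Fin 4
  step x y z s with z ≟ x | z ≟ y
  ... | yes _ | _     = readˣ s
  ... | no  _ | yes _ = readʸ s
  ... | no  _ | no  _ = s

  state : Word n → Fin n → Fin n → Fin 4
  state []      x y = 0F
  state (z ∷ w) x y = step x y z (state w x y)

  private
    Alt : Fin n → Fin n → Word n → Set
    Alt x y r = ∃[ k ] (r ≡ alternating x y k ⊎ r ≡ alternating y x k)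

    Inv : Fin n → Fin n → Fin 4 → Word n → Set
    Inv x y 0F r = r ≡ []
    Inv x y 1F r = ∃[ k ] r ≡ alternating x y (suc k)
    Inv x y 2F r = ∃[ k ] r ≡ alternating y x (suc k)
    Inv x y 3F r = ¬ Alt x y r

    Alt-tail : ∀ {x y z r} → Alt x y (z ∷ r) → Alt x y r
    Alt-tail (suc k , inj₁ eq) = k , inj₂ (∷-injectiveʳ eq)
    Alt-tail (suc k , inj₂ eq) = k , inj₁ (∷-injectiveʳ eq)
    Alt-tail (zero  , inj₁ ())
    Alt-tail (zero  , inj₂ ())

    ¬Alt-xx : ∀ {x y r} → x ≢ y → ¬ Alt x y (x ∷ x ∷ r)
    ¬Alt-xx x≢y (suc (suc k) , inj₁ eq) = x≢y (∷-injectiveˡ (∷-injectiveʳ eq))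
    ¬Alt-xx x≢y (suc k       , inj₂ eq) = x≢y (∷-injectiveˡ eq)
    ¬Alt-xx x≢y (suc zero    , inj₁ ())
    ¬Alt-xx x≢y (zero        , inj₁ ())
    ¬Alt-xx x≢y (zero        , inj₂ ())

    Alt-swap : ∀ {x y r} → Alt x y r → Alt y x r
    Alt-swap (k , inj₁ eq) = k , inj₂ eq
    Alt-swap (k , inj₂ eq) = k , inj₁ eq

    inv-readˣ : ∀ {x y} → x ≢ y → ∀ s {r} → Inv x y s r → Inv x y (readˣ s) (x ∷ r)
    inv-readˣ x≢y 0F refl       = 0 , refl
    inv-readˣ x≢y 1F (k , refl) = ¬Alt-xx x≢y
    inv-readˣ x≢y 2F (k , refl) = suc k , refl
    inv-readˣ x≢y 3F ¬alt       = ¬alt ∘ Alt-tail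

    inv-readʸ : ∀ {x y} → x ≢ y → ∀ s {r} → Inv x y s r → Inv x y (readʸ s) (y ∷ r)
    inv-readʸ x≢y 0F refl       = 0 , refl
    inv-readʸ x≢y 1F (k , refl) = suc k , refl
    inv-readʸ x≢y 2F (k , refl) = ¬Alt-xx (x≢y ∘ sym) ∘ Alt-swap
    inv-readʸ x≢y 3F ¬alt       = ¬alt ∘ Alt-tail

    inv-state : ∀ {x y} → x ≢ y → ∀ w → Inv x y (state w x y) (restrict x y w)
    inv-state x≢y [] = refl
    inv-state {x} {y} x≢y (z ∷ w) with z ≟ x | z ≟ y
    ... | yes refl | _        = inv-readˣ x≢y _ (inv-state x≢y w)
    ... | no  _    | yes refl = inv-readʸ x≢y _ (inv-state x≢y w)
    ... | no  _    | no  _    = inv-state x≢y w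

    inv⇒Alt⇔ : ∀ {x y} s {r} → Inv x y s r → Alt x y r ⇔ s ≢ 3F
    inv⇒Alt⇔ 0F eq       = mk⇔ (λ _ ()) (λ _ → 0 , inj₁ eq)
    inv⇒Alt⇔ 1F (k , eq) = mk⇔ (λ _ ()) (λ _ → suc k , inj₁ eq)
    inv⇒Alt⇔ 2F (k , eq) = mk⇔ (λ _ ()) (λ _ → suc k , inj₂ eq)
    inv⇒Alt⇔ 3F ¬alt     = mk⇔ (λ alt → contradiction alt ¬alt) (λ s≢3 → contradiction refl s≢3)

    readˣ≢0 : ∀ s → readˣ s ≢ 0F
    readˣ≢0 0F ()
    readˣ≢0 1F ()
    readˣ≢0 2F ()
    readˣ≢0 3F ()

  alternate⇔state : ∀ {x y} → x ≢ y → ∀ w → Alternate x y w ⇔ state w x y ≢ 3F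
  alternate⇔state x≢y w = inv⇒Alt⇔ _ (inv-state x≢y w)

  ∈⇒state : ∀ {x} w → x ∈ w → state w x x ≢ 0F
  ∈⇒state {x} (z ∷ w) x∈w with z ≟ x | x∈w
  ... | yes _   | _         = readˣ≢0 (state w x x)
  ... | no  z≢x | here refl = contradiction refl z≢x
  ... | no  _   | there x∈w = ∈⇒state w x∈w

  state⇒∈ : ∀ {x} w → state w x x ≢ 0F → x ∈ w
  state⇒∈ []      s≢0 = contradiction refl s≢0
  state⇒∈ {x} (z ∷ w) s≢0 with z ≟ x
  ... | yes refl = here refl
  ... | no  _    = there (state⇒∈ w s≢0)

  StateRepresents : (Fin n → Fin n → Fin 4) → Graph n → Set
  StateRepresents σ G =
    (∀ x → σ x x ≢ 0F) × (∀ x y → x ≢ y → σ x y ≢ 3F ⇔ Adjacent G x y)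

  represents⇔state : ∀ w G → Represents w G ⇔ StateRepresents (state w) G
  represents⇔state w G = mk⇔
    (λ (occ , alt) → (λ x → ∈⇒state w (occ x)) , λ x y x≢y →
      mk⇔ (to (alt x y x≢y) ∘ from (alternate⇔state x≢y w))
          (to (alternate⇔state x≢y w) ∘ from (alt x y x≢y)))
    (λ (occ , alt) → (λ x → state⇒∈ w (occ x)) , λ x y x≢y →
      mk⇔ (to (alt x y x≢y) ∘ to (alternate⇔state x≢y w))
          (from (alternate⇔state x≢y w) ∘ from (alt x y x≢y)))
    where open Equivalence

  represents? : ∀ w G → Dec (Represents w G)
  represents? w G = map′ (from (represents⇔state w G)) (to (represents⇔state w G))
    (all? (λ x → ¬? (state w x x ≟ 0F)) ×-dec
     all? (λ x → all? λ y → ¬? (x ≟ y) →-dec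
       map′ (uncurry mk⇔) (λ e → to e , from e)
         ((¬? (state w x y ≟ 3F) →-dec T? (adj G x y)) ×-dec
          (T? (adj G x y) →-dec ¬? (state w x y ≟ 3F)))))
    where open Equivalence

  infix 4 _∼_

  _∼_ : Word n → Word n → Set
  u ∼ v = ∀ x y → state u x y ≡ state v x y

  ++-congˡ : ∀ t u v → u ∼ v → t ++ u ∼ t ++ v
  ++-congˡ []      u v u∼v x y = u∼v x y
  ++-congˡ (z ∷ t) u v u∼v x y = cong (step x y z) (++-congˡ t u v u∼v x y)

  represents-∼ : ∀ u v G → u ∼ v → Represents u G → Represents v G
  represents-∼ u v G u∼v r = from (represents⇔state v G) (transfer (to (represents⇔state u G) r))
    where
    open Equivalence
    transfer : StateRepresents (state u) G → StateRepresents (state v) G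
    transfer (occ , alt) =
      (λ x → subst (_≢ 0F) (u∼v x x) (occ x)) ,
      (λ x y x≢y → subst (λ s → s ≢ 3F ⇔ Adjacent G x y) (u∼v x y) (alt x y x≢y))

  #states : ℕ
  #states = (4 ^ n) ^ n

  code : Word n → Fin #states
  code w = funToFin (λ x → funToFin (state w x))

  decode : ∀ w x y → finToFun (finToFun (code w) x) y ≡ state w x y
  decode w x y = trans
    (cong (λ c → finToFun c y) (finToFun-funToFin (λ x → funToFin (state w x)) x))
    (finToFun-funToFin (state w x) y)

  code-injective : ∀ u v → code u ≡ code v → u ∼ v
  code-injective u v eq x y = trans (sym (decode u x y))
    (trans (cong (λ c → finToFun (finToFun c x) y) eq) (decode v x y))

  private
    cut-shorter : ∀ (w : Word n) {i j} → i < j → j ≤ length w →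
                  length (take i w ++ drop j w) < length w
    cut-shorter w {i} {j} i<j j≤ = begin-strict
      length (take i w ++ drop j w)          ≡⟨ length-++ (take i w) ⟩
      length (take i w) + length (drop j w)  ≡⟨ cong₂ _+_ (length-take i w) (length-drop j w) ⟩
      i ⊓ length w + (length w ∸ j)          ≤⟨ ℕ.+-monoˡ-≤ _ (ℕ.m⊓n≤m i (length w)) ⟩
      i + (length w ∸ j)                     <⟨ ℕ.+-monoˡ-< _ i<j ⟩
      j + (length w ∸ j)                     ≡⟨ ℕ.m+[n∸m]≡n j≤ ⟩
      length w                               ∎
      where open ℕ.≤-Reasoning

  shorten : ∀ w → #states ≤ length w → ∃[ u ] length u < length w × u ∼ w
  shorten w long
    with i , j , i<j , eq ← pigeonhole (s≤s long) (λ i → code (drop (toℕ i) w)) =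
    take (toℕ i) w ++ drop (toℕ j) w ,
    cut-shorter w i<j (s≤s⁻¹ (toℕ<n j)) ,
    subst (take (toℕ i) w ++ drop (toℕ j) w ∼_) (take++drop≡id (toℕ i) w)
      (++-congˡ (take (toℕ i) w) _ _
        (code-injective (drop (toℕ j) w) (drop (toℕ i) w) (sym eq)))

  shortWord : ∀ {G} w → Represents w G → ∃[ u ] length u < #states × Represents u G
  shortWord {G} w r = go w r (<-wellFounded (length w))
    where
    go : ∀ w → Represents w G → Acc _<_ (length w) → ∃[ u ] length u < #states × Represents u G
    go w r (acc rec) with length w ℕ.<? #states
    ... | yes short = w , short , r
    ... | no  long with u , u<w , u∼w ← shorten w (ℕ.≮⇒≥ long) =
      go u (represents-∼ w u G (λ x y → sym (u∼w x y)) r) (rec u<w)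

  boundedWord? : {P : Word n → Set} → (∀ w → Dec (P w)) →
                 ∀ k → Dec (∃[ w ] length w < k × P w)
  boundedWord? P? zero = no λ ()
  boundedWord? {P} P? (suc k) = map′ join split
    (P? [] ⊎-dec any? (λ z → boundedWord? (λ w → P? (z ∷ w)) k))
    where
    join : P [] ⊎ (∃[ z ] ∃[ w ] length w < k × P (z ∷ w)) → ∃[ w ] length w < suc k × P w
    join (inj₁ p)               = [] , z<s , p
    join (inj₂ (z , w , l , p)) = z ∷ w , s≤s l , p
    split : (∃[ w ] length w < suc k × P w) → P [] ⊎ (∃[ z ] ∃[ w ] length w < k × P (z ∷ w))
    split ([]    , _ , p) = inj₁ p
    split (z ∷ w , l , p) = inj₂ (z , w , s≤s⁻¹ l , p)

  wordRepresentable? : (G : Graph n) → Dec (WordRepresentable G)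
  wordRepresentable? G = map′
    (λ (w , _ , r) → w , r)
    (λ (w , r) → shortWord {G} w r)
    (boundedWord? (λ w → represents? w G) #states)

-- Isomorphism is decidable, and up to pointwise equality of adjacency
-- every graph appears in a finite enumeration.

module _ {n : ℕ} where

  infix 4 _≗ᴳ_

  _≗ᴳ_ : Graph n → Graph n → Set
  G ≗ᴳ H = ∀ x y → adj G x y ≡ adj H x y

  ≗ᴳ⇒≅ : ∀ {G H} → G ≗ᴳ H → G ≅ H
  ≗ᴳ⇒≅ eq = Perm.id , λ x y → sym (eq x y)

  wordRepresentable-≗ᴳ : ∀ {G H} → G ≗ᴳ H → WordRepresentable G → WordRepresentable H
  wordRepresentable-≗ᴳ eq (w , occ , alt) = w , occ , λ x y x≢y →
    subst (λ b → Alternate x y w ⇔ T b) (eq x y) (alt x y x≢y)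

  infix 4 _≅?_

  _≅?_ : (G H : Graph n) → Dec (G ≅ H)
  G ≅? H = map′ join split
    (any? λ i → any? λ j →
      (all? λ x → finToFun i (finToFun j x) ≟ x) ×-dec
      (all? λ x → finToFun j (finToFun i x) ≟ x) ×-dec
      (all? λ x → all? λ y → adj H (finToFun i x) (finToFun i y) ≟ᵇ adj G x y))
    where
    Code : Fin (n ^ n) → Fin (n ^ n) → Set
    Code i j =
      (∀ x → finToFun {n} {n} i (finToFun j x) ≡ x) ×
      (∀ x → finToFun {n} {n} j (finToFun i x) ≡ x) ×
      (∀ x y → adj H (finToFun i x) (finToFun i y) ≡ adj G x y)
    join : ∃₂ Code → G ≅ H
    join (i , j , ij , ji , eq) = permutation (finToFun i) (finToFun j) ij ji , eq
    split : G ≅ H → ∃₂ Code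
    split (π , eq) = funToFin to , funToFin from ,
      (λ x → trans (to≗ _) (trans (cong to (from≗ x)) (Perm.inverseʳ π))) ,
      (λ x → trans (from≗ _) (trans (cong from (to≗ x)) (Perm.inverseˡ π))) ,
      (λ x y → trans (cong₂ (adj H) (to≗ x) (to≗ y)) (eq x y))
      where
      to from : Fin n → Fin n
      to   = π ⟨$⟩ʳ_
      from = π ⟨$⟩ˡ_
      to≗   = finToFun-funToFin to
      from≗ = finToFun-funToFin from

  symmetrise : (Fin n → Fin n → Bool) → Graph n
  symmetrise f = record { adj = sadj ; adj-sym = ssym ; adj-irrefl = sirr }
    where
    sadj : Fin n → Fin n → Bool
    sadj x y with <-cmp x y
    ... | tri< _ _ _ = f x y
    ... | tri≈ _ _ _ = false
    ... | tri> _ _ _ = f y x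
    ssym : ∀ x y → sadj x y ≡ sadj y x
    ssym x y with <-cmp x y | <-cmp y x
    ... | tri< _ _ _   | tri> _ _ _   = refl
    ... | tri≈ _ _ _   | tri≈ _ _ _   = refl
    ... | tri> _ _ _   | tri< _ _ _   = refl
    ... | tri< _ x≢y _ | tri≈ _ y≡x _ = contradiction (sym y≡x) x≢y
    ... | tri< a _ ¬c  | tri< b _ _   = contradiction b ¬c
    ... | tri≈ _ x≡y _ | tri< _ y≢x _ = contradiction (sym x≡y) y≢x
    ... | tri≈ _ x≡y _ | tri> _ y≢x _ = contradiction (sym x≡y) y≢x
    ... | tri> _ x≢y _ | tri≈ _ y≡x _ = contradiction (sym y≡x) x≢y
    ... | tri> ¬a _ c  | tri> _ _ b   = contradiction b ¬a
    sirr : ∀ x → sadj x x ≡ false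
    sirr x with <-cmp x x
    ... | tri< _ x≢x _ = contradiction refl x≢x
    ... | tri≈ _ _ _   = refl
    ... | tri> _ x≢x _ = contradiction refl x≢x

  symmetrise-≗ᴳ : ∀ f G → (∀ x y → f x y ≡ adj G x y) → symmetrise f ≗ᴳ G
  symmetrise-≗ᴳ f G eq x y with <-cmp x y
  ... | tri< _ _ _    = eq x y
  ... | tri≈ _ refl _ = sym (adj-irrefl G x)
  ... | tri> _ _ _    = trans (eq y x) (adj-sym G y x)

  private
    bit : Fin 2 → Bool
    bit 0F = false
    bit 1F = true

    unbit : Bool → Fin 2
    unbit false = 0F
    unbit true  = 1F

    bit-unbit : ∀ b → bit (unbit b) ≡ b
    bit-unbit false = refl
    bit-unbit true  = refl

  graph : Fin ((2 ^ n) ^ n) → Graph n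
  graph i = symmetrise λ x y → bit (finToFun (finToFun i x) y)

  graph-surjective : ∀ G → ∃[ i ] graph i ≗ᴳ G
  graph-surjective G = funToFin row , symmetrise-≗ᴳ _ G λ x y → begin
    bit (finToFun (finToFun (funToFin row) x) y)  ≡⟨ cong (λ r → bit (finToFun r y)) (finToFun-funToFin row x) ⟩
    bit (finToFun (row x) y)                      ≡⟨ cong bit (finToFun-funToFin (unbit ∘ adj G x) y) ⟩
    bit (unbit (adj G x y))                       ≡⟨ bit-unbit _ ⟩
    adj G x y                                     ∎
    where
    open ≡-Reasoning
    row : Fin n → Fin (2 ^ n)
    row x = funToFin (unbit ∘ adj G x)

module _ (S : Setoid 0ℓ 0ℓ) (_≈?_ : ∀ x y → Dec (Setoid._≈_ S x y)) where

  open Setoid S using (Carrier; _≈_) renaming (sym to ≈-sym; trans to ≈-trans)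

  private
    Reps : (Carrier → Set) → Set
    Reps P = ∃[ a ] Σ (Fin a → Carrier) λ f →
      (∀ {i j} → f i ≈ f j → i ≡ j) × (∀ {x} → P x → ∃[ i ] f i ≈ x)

  -- Every element is equal to some value of a finite partial family.
  representatives : ∀ m {D : Fin m → Set} → (∀ i → Dec (D i)) → (e : ∀ i → D i → Carrier) →
                    (∀ i d d′ → e i d ≈ e i d′) →
                    Reps (λ x → ∃₂ λ i d → e i d ≈ x)
  representatives zero D? e e-irr = 0 , (λ ()) , (λ { {()} }) , λ ()
  representatives (suc m) D? e e-irr
    with a , f , inj , sur ← representatives m (D? ∘ suc) (e ∘ suc) (e-irr ∘ suc)
    with D? zero
  ... | no ¬d = a , f , inj , λ where
    (zero  , d , _) → contradiction d ¬d
    (suc i , p)     → sur (i , p)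
  ... | yes d with any? (λ i → f i ≈? e zero d)
  ...   | yes (i , fi≈) = a , f , inj , λ where
    (zero  , d′ , e≈x) → i , ≈-trans fi≈ (≈-trans (e-irr zero d d′) e≈x)
    (suc i , p)        → sur (i , p)
  ...   | no  new = suc a , g , (λ {i} {j} → g-inj i j) , λ where
      (zero  , d′ , e≈x) → zero , ≈-trans (e-irr zero d d′) e≈x
      (suc i , p)        → let j , eq = sur (i , p) in suc j , eq
    where
    g : Fin (suc a) → Carrier
    g zero    = e zero d
    g (suc i) = f i
    g-inj : ∀ i j → g i ≈ g j → i ≡ j
    g-inj zero    zero    _  = refl
    g-inj zero    (suc j) eq = contradiction (j , ≈-sym eq) new
    g-inj (suc i) zero    eq = contradiction (i , eq) new
    g-inj (suc i) (suc j) eq = cong suc (inj eq)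

numberOfClasses : ∀ n → ∃[ a ] HasCardinality (WordRepresentableGraphs n) a
numberOfClasses n
  with a , f , inj , sur ← representatives (WordRepresentableGraphs n)
         (λ G H → proj₁ G ≅? proj₁ H) _
         (λ i → wordRepresentable? (graph i)) (λ i r → graph i , r)
         (λ i _ _ → ≅-refl {G = graph i})
  = a , record
    { to        = f
    ; cong      = λ { {i} refl → ≅-refl {G = proj₁ (f i)} }
    ; bijective = inj , λ (G , r) →
        let i , eq = graph-surjective G
            j , fj≅ = sur {G , r}
              ( i
              , wordRepresentable-≗ᴳ {G = G} {H = graph i} (λ x y → sym (eq x y)) r
              , ≗ᴳ⇒≅ {G = graph i} {H = G} eq
              )
        in j , λ { refl → fj≅ }
    }

#wordRepresentable : ℕ → ℕ
#wordRepresentable n = proj₁ (numberOfClasses n)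

{-# OPTIONS --safe #-}
-- Lower bound: every 3-colourable graph is word-representable, by a concatenation of words each of
-- which contains every letter twice, keeps the edges alternating and breaks one non-edge.  Three
-- classes of k vertices with arbitrary edges between them give 2 ^ (3 k²) labelled graphs, and an
-- isomorphism class contains at most n ^ n of these.
--
-- Upper bound: ordering the letters by first occurrence, a word-representable graph has no shortcut
-- on four vertices, i.e. no a < b < c < d with edges ab, bc, cd, ad of which ac or bd is not an
-- edge.  Hence a vertex outside a complete tripartite subgraph A < B < C with parts of size m is
-- joined to all or to none of one part: it has at most 6 · 2 ^ (2 m) neighbourhoods in these 3 m
-- vertices.  Removing such subgraphs as long as possible costs 2/3 + o(1) bits for each pair of a
-- removed and a remaining vertex, which adds up to n² / 3 + o(n²) bits.  Once there is no complete
-- tripartite subgraph with large parts, all but boundedly many vertices have few neighbours in one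
-- part of a given complete bipartite subgraph, and these subgraphs are removed in the same way;
-- once there are none of these either, the argument is repeated with single sets of vertices.
-- Graphs are encoded only up to isomorphism, so the removed vertices need not be named.
module Submission where

open import Data.Bool.Base using (Bool; true; false; T; not; _∧_; _∨_)
open import Data.Bool.Properties using (T?; ∨-comm; ∨-identityʳ; T-∨) renaming (_≟_ to _≟ᵇ_)
open import Data.Empty using (⊥; ⊥-elim)
import Data.Fin.Base as Fin
open import Data.Fin.Base
  using (Fin; zero; suc; cast; _↑ˡ_; combine; remQuot; splitAt; finToFun; funToFin)
open import Data.Fin.Patterns using (0F; 1F; 2F; 3F)
open import Data.Fin.Permutation using (permutation; _⟨$⟩ʳ_)
import Data.Fin.Properties as Fin
open import Data.Fin.Properties
  using ( _≟_; injective⇒≤; splitAt-↑ˡ; remQuot-combine; combine-injective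
        ; funToFin-finToFin; finToFun-funToFin; cast-involutive)
open import Data.List.Base
  using ( List; []; _∷_; _++_; length; map; filter; foldr; concat; concatMap; zipWith; take; lookup
        ; replicate; tails; allFin; cartesianProduct; cartesianProductWith)
open import Data.List.Membership.Propositional using (_∈_; _∉_; find; lose)
open import Data.List.Membership.Propositional.Properties
  using ( ∈-++⁺ˡ; ∈-++⁺ʳ; ∈-++⁻; ∈-∃++; ∈-filter⁺; ∈-filter⁻; ∈-allFin; ∈-lookup
        ; ∈-cartesianProduct⁺; ∈-cartesianProductWith⁺)
open import Data.List.Properties
  using ( length-++; length-map; length-take; length-tabulate; map-++; concat-map; filter-all
        ; filter-none; ++-assoc; ++-identityʳ; ∷-injectiveˡ; ∷-injectiveʳ; ≡-dec)
open import Data.List.Relation.Binary.Permutation.Propositional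
  using (_↭_; ↭-refl; ↭-reflexive; ↭-prep; ↭-swap; ↭-sym; ↭-trans; ↭⇒↭ₛ)
open import Data.List.Relation.Binary.Permutation.Propositional.Properties
  using (↭-length; filter-↭; shift; ∈-resp-↭; All-resp-↭)
  renaming (map⁺ to ↭-map⁺; ++⁺ʳ to ↭-++⁺ʳ)
import Data.List.Relation.Binary.Permutation.Setoid.Properties as ↭ₛ
open import Data.List.Relation.Unary.All as All using (All; []; _∷_; all?)
import Data.List.Relation.Unary.All.Properties as All
open import Data.List.Relation.Unary.AllPairs as AllPairs using (AllPairs; []; _∷_; allPairs?)
import Data.List.Relation.Unary.AllPairs.Properties as AllPairs
open import Data.List.Relation.Unary.Any as Any using (Any; here; there; any?; satisfied; index)
import Data.List.Relation.Unary.Any.Properties as Any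
import Data.List.Relation.Unary.Unique.DecPropositional as UniqueDec
open import Data.List.Relation.Unary.Unique.Propositional using (Unique)
import Data.List.Relation.Unary.Unique.Propositional.Properties as Unique
open import Data.Maybe.Base using (Maybe; just; nothing; _>>=_)
import Data.Maybe.Properties as Maybe
open import Data.Nat.Base
  using ( ℕ; zero; suc; _+_; _*_; _^_; _∸_; _⊔_; _≤_; _<_; z≤n; s≤s; s≤s⁻¹
        ; NonZero; >-nonZero; >-nonZero⁻¹)
open import Data.Nat.DivMod using (_/_; _%_; m≡m%n+[m/n]*n; m%n<n)
open import Data.Nat.Induction using (<-wellFounded; Acc; acc)
import Data.Nat.Properties as ℕ
open import Data.Nat.Tactic.RingSolver using (solve-∀)
open import Data.Product.Base using (_×_; _,_; proj₁; proj₂; ∃-syntax)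
open import Data.Sum.Base using (_⊎_; inj₁; inj₂)
open import Function.Base using (_∘_; id)
open import Function.Bundles using (Bijection; Equivalence; mk⇔)
open import Level using (0ℓ)
open import Relation.Binary.Definitions using (DecidableEquality; tri<; tri≈; tri>)
open import Relation.Binary.PropositionalEquality
  using (_≡_; _≢_; refl; sym; trans; cong; cong₂; subst; subst₂; setoid; module ≡-Reasoning)
open import Relation.Nullary using (¬_; Dec; yes; no; does; contradiction)
open import Relation.Nullary.Decidable
  using (¬?; decidable-stable; from-yes; map′; _×-dec_; _⊎-dec_; _→-dec_)
open import Relation.Unary using (Pred; Decidable)
open import Defs hiding (code; decode; step)

-- Words and shortcuts

module _ {n : ℕ} where

  # : Fin n → Word n → ℕ
  # x []      = 0
  # x (z ∷ w) with z ≟ x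
  ... | yes _ = suc (# x w)
  ... | no  _ = # x w

  #-here : ∀ x w → # x (x ∷ w) ≡ suc (# x w)
  #-here x w with x ≟ x
  ... | yes _   = refl
  ... | no  x≢x = contradiction refl x≢x

  #-skip : ∀ {x z} → z ≢ x → ∀ w → # x (z ∷ w) ≡ # x w
  #-skip {x} {z} z≢x w with z ≟ x
  ... | yes z≡x = contradiction z≡x z≢x
  ... | no  _   = refl

  -- Words are read from the right, as by the automaton in Defs, hence the suffixes (tails).
  AheadBy≤1 : Fin n → Fin n → Word n → Set
  AheadBy≤1 x y s = # y s ≤ # x s × # x s ≤ suc (# y s)

  -- Alternation with a direction: read from the right, `x` and `y` take turns, starting with `x`.
  -- Inequalities between counts can be chained along a path of letters.
  Leads : Fin n → Fin n → Word n → Set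
  Leads x y w = All (AheadBy≤1 x y) (tails w)

  private
    head : ∀ {x y} w → Leads x y w → AheadBy≤1 x y w
    head []      (p ∷ _) = p
    head (_ ∷ _) (p ∷ _) = p

    -- w is nonempty on {x , y} and x is its leftmost such letter.
    XFirst : Fin n → Fin n → Word n → Set
    XFirst x y w = (Leads x y w × # x w ≡ suc (# y w))
                 ⊎ (Leads y x w × ¬ Leads x y w × # x w ≡ # y w)

    LeadInv : Fin n → Fin n → Fin 4 → Word n → Set
    LeadInv x y 0F w = Leads x y w × Leads y x w × # x w ≡ # y w
    LeadInv x y 1F w = XFirst x y w
    LeadInv x y 2F w = XFirst y x w
    LeadInv x y 3F w = ¬ Leads x y w × ¬ Leads y x w

    module _ {x y : Fin n} (x≢y : x ≢ y) (w : Word n) where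

      private
        #x : # x (x ∷ w) ≡ suc (# x w)
        #x = #-here x w
        #y : # y (x ∷ w) ≡ # y w
        #y = #-skip x≢y w

        extend : Leads x y w → # x w ≡ # y w → Leads x y (x ∷ w) × # x (x ∷ w) ≡ suc (# y (x ∷ w))
        extend l eq =
          (subst₂ _≤_ (sym #y) (sym #x) (ℕ.m≤n⇒m≤1+n (ℕ.≤-reflexive (sym eq))) , ℕ.≤-reflexive eq′) ∷ l ,
          eq′
          where
          eq′ : # x (x ∷ w) ≡ suc (# y (x ∷ w))
          eq′ = trans #x (cong suc (trans eq (sym #y)))

      read-first : Leads x y w × Leads y x w × # x w ≡ # y w → XFirst x y (x ∷ w)
      read-first (l , _ , eq) = inj₁ (extend l eq)

      read-alternately : XFirst y x w → XFirst x y (x ∷ w)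
      read-alternately (inj₁ (l , eq)) = inj₂
        ( (ℕ.≤-reflexive eq′ , ℕ.m≤n⇒m≤1+n (ℕ.≤-reflexive (sym eq′))) ∷ l
        , (λ { (_ ∷ l′) → ℕ.1+n≰n (subst (_≤ # x w) eq (proj₁ (head w l′))) })
        , eq′)
        where
        eq′ : # x (x ∷ w) ≡ # y (x ∷ w)
        eq′ = trans #x (trans (sym eq) (sym #y))
      read-alternately (inj₂ (l , _ , eq)) = inj₁ (extend l (sym eq))

      -- A second `x` in a row puts `x` two ahead of `y`, or one ahead where `y` was leading. The
      -- opposite direction already fails in `w`.
      read-repeated : XFirst x y w → ¬ Leads x y (x ∷ w) × ¬ Leads y x (x ∷ w)
      read-repeated (inj₁ (l , eq)) =
        (λ { ((_ , p) ∷ _) → ℕ.1+n≰n (subst₂ _≤_ (trans #x (cong suc eq)) (cong suc #y) p) }) ,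
        (λ { (_ ∷ l′) → ℕ.1+n≰n (subst (_≤ # y w) eq (proj₁ (head w l′))) })
      read-repeated (inj₂ (l , ¬l , eq)) =
        (λ { (_ ∷ l′) → ¬l l′ }) ,
        (λ { ((p , _) ∷ _) → ℕ.1+n≰n (subst₂ _≤_ (trans #x (cong suc eq)) #y p) })

    skip : ∀ {x y z} → z ≢ x → z ≢ y → ∀ {w} → Leads x y w → Leads x y (z ∷ w)
    skip z≢x z≢y {w} l =
      subst₂ (λ a b → b ≤ a × a ≤ suc b) (sym (#-skip z≢x w)) (sym (#-skip z≢y w)) (head w l) ∷ l

    skip-XFirst : ∀ {x y z} → z ≢ x → z ≢ y → ∀ {w} → XFirst x y w → XFirst x y (z ∷ w)
    skip-XFirst z≢x z≢y {w} (inj₁ (l , eq)) =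
      inj₁ (skip z≢x z≢y l , trans (#-skip z≢x w) (trans eq (cong suc (sym (#-skip z≢y w)))))
    skip-XFirst z≢x z≢y {w} (inj₂ (l , ¬l , eq)) =
      inj₂ (skip z≢y z≢x l , (λ { (_ ∷ l′) → ¬l l′ }) , trans (#-skip z≢x w) (trans eq (sym (#-skip z≢y w))))

    ¬Leads-∷ : ∀ {x y} z {w} → ¬ Leads x y w × ¬ Leads y x w → ¬ Leads x y (z ∷ w) × ¬ Leads y x (z ∷ w)
    ¬Leads-∷ z (¬l , ¬l′) = (λ { (_ ∷ l) → ¬l l }) , (λ { (_ ∷ l) → ¬l′ l })

    leadInv : ∀ {x y} → x ≢ y → ∀ w → LeadInv x y (state w x y) w
    leadInv x≢y [] = (z≤n , z≤n) ∷ [] , (z≤n , z≤n) ∷ [] , refl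
    leadInv {x} {y} x≢y (z ∷ w) with z ≟ x | z ≟ y | state w x y | leadInv x≢y w
    ... | yes refl | _ | 0F | i = read-first x≢y w i
    ... | yes refl | _ | 1F | i = read-repeated x≢y w i
    ... | yes refl | _ | 2F | i = read-alternately x≢y w i
    ... | yes refl | _ | 3F | i = ¬Leads-∷ x i
    ... | no _ | yes refl | 0F | l , l′ , eq = read-first (x≢y ∘ sym) w (l′ , l , sym eq)
    ... | no _ | yes refl | 1F | i = read-alternately (x≢y ∘ sym) w i
    ... | no _ | yes refl | 2F | i = let p , q = read-repeated (x≢y ∘ sym) w i in q , p
    ... | no _ | yes refl | 3F | i = ¬Leads-∷ y i
    ... | no z≢x | no z≢y | 0F | l , l′ , eq =
      skip z≢x z≢y l , skip z≢y z≢x l′ , trans (#-skip z≢x w) (trans eq (sym (#-skip z≢y w)))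
    ... | no z≢x | no z≢y | 1F | i = skip-XFirst z≢x z≢y i
    ... | no z≢x | no z≢y | 2F | i = skip-XFirst z≢y z≢x i
    ... | no z≢x | no z≢y | 3F | i = ¬Leads-∷ z i

  state≢3⇒leads : ∀ {x y} → x ≢ y → ∀ w → state w x y ≢ 3F → Leads x y w ⊎ Leads y x w
  state≢3⇒leads {x} {y} x≢y w s≢3 with state w x y | leadInv x≢y w
  ... | 0F | l , _            = inj₁ l
  ... | 1F | inj₁ (l , _)     = inj₁ l
  ... | 1F | inj₂ (l , _)     = inj₂ l
  ... | 2F | inj₁ (l , _)     = inj₂ l
  ... | 2F | inj₂ (l , _)     = inj₁ l
  ... | 3F | _                = contradiction refl s≢3

  leads⇒state≢3 : ∀ {x y} → x ≢ y → ∀ w → Leads x y w → state w x y ≢ 3F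
  leads⇒state≢3 {x} {y} x≢y w l s≡3 with state w x y | leadInv x≢y w | s≡3
  ... | 3F | ¬l , _ | refl = ¬l l

  leads⇒alternate : ∀ {x y} → x ≢ y → ∀ w → Leads x y w → Alternate x y w
  leads⇒alternate x≢y w l = Equivalence.from (alternate⇔state x≢y w) (leads⇒state≢3 x≢y w l)

  alternate⇒leads : ∀ {x y} → x ≢ y → ∀ w → Alternate x y w → Leads x y w ⊎ Leads y x w
  alternate⇒leads x≢y w a = state≢3⇒leads x≢y w (Equivalence.to (alternate⇔state x≢y w) a)

  -- With a before b before c before d, the four lead counts are weakly decreasing and the last
  -- is at most one behind the first, so any two of them differ by at most one.
  leads-shortcut : ∀ {a b c d} w → Leads a b w → Leads b c w → Leads c d w → Leads a d w →
                   Leads a c w × Leads b d w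
  leads-shortcut w ab bc cd ad =
    All.zipWith (λ ((b≤a , _) , (c≤b , _) , (d≤c , _) , _ , a≤1+d) →
      ℕ.≤-trans c≤b b≤a , ℕ.≤-trans a≤1+d (s≤s d≤c)) all ,
    All.zipWith (λ ((b≤a , _) , (c≤b , _) , (d≤c , _) , _ , a≤1+d) →
      ℕ.≤-trans d≤c c≤b , ℕ.≤-trans b≤a a≤1+d) all
    where
    all = ab , All.zip (bc , All.zip (cd , ad))

  -- The number of letters read from the right before the first `x`, which is `length w` if `x` is
  -- absent.
  rank : Fin n → Word n → ℕ
  rank x []      = 0
  rank x (z ∷ w) with # x (z ∷ w)
  ... | zero  = suc (rank x w)
  ... | suc _ = rank x w

  -- A suffix without `x` has no `y` either, as `y` is never ahead.
  leads⇒rank≤ : ∀ {x y} w → Leads x y w → rank x w ≤ rank y w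
  leads⇒rank≤ []      _ = z≤n
  leads⇒rank≤ {x} {y} (z ∷ w) ((#y≤#x , _) ∷ l) with # x (z ∷ w) | # y (z ∷ w) | #y≤#x
  ... | zero  | zero  | _ = s≤s (leads⇒rank≤ w l)
  ... | suc _ | zero  | _ = ℕ.m≤n⇒m≤1+n (leads⇒rank≤ w l)
  ... | suc _ | suc _ | _ = leads⇒rank≤ w l

  rank≤length : ∀ x w → rank x w ≤ length w
  rank≤length x []      = z≤n
  rank≤length x (z ∷ w) with # x (z ∷ w)
  ... | zero  = s≤s (rank≤length x w)
  ... | suc _ = ℕ.m≤n⇒m≤1+n (rank≤length x w)

  rank-absent : ∀ x w → # x w ≡ 0 → rank x w ≡ length w
  rank-absent x []      _  = refl
  rank-absent x (z ∷ w) #≡0 with z ≟ x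
  ... | no _ rewrite #≡0 = cong suc (rank-absent x w #≡0)

  rank<length : ∀ x w → # x w ≢ 0 → rank x w < length w
  rank<length x []      #≢0 = contradiction refl #≢0
  rank<length x (z ∷ w) #≢0 with # x (z ∷ w)
  ... | zero  = contradiction refl #≢0
  ... | suc _ = s≤s (rank≤length x w)

  rank-present : ∀ x z w → # x (z ∷ w) ≢ 0 → rank x (z ∷ w) ≡ rank x w
  rank-present x z w #≢0 with # x (z ∷ w)
  ... | zero  = contradiction refl #≢0
  ... | suc _ = refl

  -- If the head is only one of the two letters, the other occurs in the tail and its rank there is
  -- below the length of the tail. By equality of ranks the head letter occurs in the tail too, and
  -- the induction applies.
  rank-injective : ∀ {x y} w → # x w ≢ 0 → # y w ≢ 0 → rank x w ≡ rank y w → x ≡ y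
  rank-injective []      #x≢0 _ _ = contradiction refl #x≢0
  rank-injective {x} {y} (z ∷ w) #x≢0 #y≢0 eq = go (z ≟ x) (z ≟ y)
    where
    eq′ : rank x w ≡ rank y w
    eq′ = trans (sym (rank-present x z w #x≢0)) (trans eq (rank-present y z w #y≢0))

    first-below : ∀ {a b} → # a w ≢ 0 → rank a w ≡ rank b w → # b w ≢ 0
    first-below {a} {b} #a≢0 eq #b≡0 =
      ℕ.<⇒≢ (rank<length a w #a≢0) (trans eq (rank-absent b w #b≡0))

    go : Dec (z ≡ x) → Dec (z ≡ y) → x ≡ y
    go (yes z≡x) (yes z≡y) = trans (sym z≡x) z≡y
    go (yes z≡x) (no z≢y)  = rank-injective w (first-below #y′ (sym eq′)) #y′ eq′
      where #y′ = #y≢0 ∘ trans (#-skip z≢y w)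
    go (no z≢x)  (yes z≡y) = rank-injective w #x′ (first-below #x′ eq′) eq′
      where #x′ = #x≢0 ∘ trans (#-skip z≢x w)
    go (no z≢x)  (no z≢y)  =
      rank-injective w (#x≢0 ∘ trans (#-skip z≢x w)) (#y≢0 ∘ trans (#-skip z≢y w)) eq′

  ∈⇒#≢0 : ∀ {x} w → x ∈ w → # x w ≢ 0
  ∈⇒#≢0 {x} (z ∷ w) x∈w with z ≟ x | x∈w
  ... | yes _  | _         = λ ()
  ... | no z≢x | here refl = contradiction refl z≢x
  ... | no _   | there p   = ∈⇒#≢0 w p

-- Only the shortcuts on four vertices of a semi-transitive orientation are needed.
record ShortcutFree {n} (G : Graph n) : Set where
  field
    position           : Fin n → ℕ
    position-injective : ∀ {x y} → position x ≡ position y → x ≡ y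
    no-shortcut        : ∀ {a b c d} →
      position a < position b → position b < position c → position c < position d →
      Adjacent G a b → Adjacent G b c → Adjacent G c d → Adjacent G a d →
      Adjacent G a c × Adjacent G b d

-- Of two adjacent letters the one of smaller rank leads, since the other one leading would reverse
-- the ranks. Then `leads-shortcut` supplies the diagonals.
wordRepresentable⇒shortcutFree : ∀ {n} {G : Graph n} → WordRepresentable G → ShortcutFree G
wordRepresentable⇒shortcutFree {n} {G} (w , occurs , rep) = record
  { position           = λ x → rank x w
  ; position-injective = λ {x} {y} → rank-injective w (∈⇒#≢0 w (occurs x)) (∈⇒#≢0 w (occurs y))
  ; no-shortcut        = λ a<b b<c c<d ab bc cd ad →
      let a<c = ℕ.<-trans a<b b<c
          b<d = ℕ.<-trans b<c c<d
          ac , bd = leads-shortcut w (leads a<b ab) (leads b<c bc) (leads c<d cd)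
                                     (leads (ℕ.<-trans a<c c<d) ad)
      in adjacent a<c ac , adjacent b<d bd
  }
  where
  distinct : ∀ {x y} → rank x w < rank y w → x ≢ y
  distinct x<y refl = ℕ.<-irrefl refl x<y

  adjacent : ∀ {x y} → rank x w < rank y w → Leads x y w → Adjacent G x y
  adjacent {x} {y} x<y l =
    Equivalence.to (rep x y (distinct x<y)) (leads⇒alternate (distinct x<y) w l)

  leads : ∀ {x y} → rank x w < rank y w → Adjacent G x y → Leads x y w
  leads {x} {y} x<y e with alternate⇒leads (distinct x<y) w (Equivalence.from (rep x y (distinct x<y)) e)
  ... | inj₁ l = l
  ... | inj₂ l = contradiction (leads⇒rank≤ w l) (ℕ.<⇒≱ x<y)

-- Enumerating lists

private
  variable
    X Y Z : Set

length-cartesianProductWith : ∀ (f : X → Y → Z) xs ys →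
  length (cartesianProductWith f xs ys) ≡ length xs * length ys
length-cartesianProductWith f []       ys = refl
length-cartesianProductWith f (x ∷ xs) ys =
  trans (length-++ (map (f x) ys)) (cong₂ _+_ (length-map (f x) ys) (length-cartesianProductWith f xs ys))

^-distribʳ-* : ∀ a b n → (a * b) ^ n ≡ a ^ n * b ^ n
^-distribʳ-* a b zero    = refl
^-distribʳ-* a b (suc n) = trans (cong (a * b *_) (^-distribʳ-* a b n)) (interchange a b (a ^ n) (b ^ n))
  where
  interchange : ∀ a b c d → a * b * (c * d) ≡ a * c * (b * d)
  interchange = solve-∀

-- The allowance of `x` entries from `bad` need not be used up.
mostly : List X → List X → (n x : ℕ) → List (List X)
mostly good bad zero    x       = [] ∷ []
mostly good bad (suc n) zero    = cartesianProductWith _∷_ good (mostly good bad n zero)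
mostly good bad (suc n) (suc x) = cartesianProductWith _∷_ good (mostly good bad n (suc x))
                               ++ cartesianProductWith _∷_ bad (mostly good bad n x)

module _ {Bad : Pred X 0ℓ} (Bad? : Decidable Bad) {good bad : List X} where

  ∈-mostly : ∀ x ys → All (λ y → (¬ Bad y → y ∈ good) × (Bad y → y ∈ bad)) ys →
             length (filter Bad? ys) ≤ x → ys ∈ mostly good bad (length ys) x
  ∈-mostly x       []       _              _   = here refl
  ∈-mostly zero    (y ∷ ys) ((g , b) ∷ ps) few with Bad? y
  ... | no ¬bad = ∈-cartesianProductWith⁺ _∷_ (g ¬bad) (∈-mostly zero ys ps few)
  ∈-mostly (suc x) (y ∷ ys) ((g , b) ∷ ps) few with Bad? y
  ... | no ¬bad = ∈-++⁺ˡ (∈-cartesianProductWith⁺ _∷_ (g ¬bad) (∈-mostly (suc x) ys ps few))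
  ... | yes bad = ∈-++⁺ʳ _ (∈-cartesianProductWith⁺ _∷_ (b bad) (∈-mostly x ys ps (s≤s⁻¹ few)))

-- Chernoff-style: giving each good entry weight ℓ, a list with at most x bad entries has weight
-- at least ℓ ^ (n ∸ x), while the total weight of all lists is (ℓ * g + b) ^ n.
length-mostly : ∀ ℓ .{{_ : NonZero ℓ}} (good bad : List X) n x →
  length (mostly good bad n x) * ℓ ^ n ≤ (ℓ * length good + length bad) ^ n * ℓ ^ x
length-mostly ℓ good bad zero x = subst (1 ≤_) (sym (ℕ.*-identityˡ _)) (ℕ.m^n>0 ℓ x)
length-mostly ℓ good bad (suc n) zero = begin
  length (cartesianProductWith _∷_ good G) * (ℓ * ℓ ^ n)
    ≡⟨ cong (_* (ℓ * ℓ ^ n)) (length-cartesianProductWith _∷_ good G) ⟩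
  g * length G * (ℓ * ℓ ^ n)
    ≡⟨ lhs g (length G) ℓ (ℓ ^ n) ⟩
  ℓ * g * (length G * ℓ ^ n)
    ≤⟨ ℕ.*-mono-≤ (ℕ.m≤m+n (ℓ * g) b) (length-mostly ℓ good bad n zero) ⟩
  (ℓ * g + b) * ((ℓ * g + b) ^ n * 1)
    ≡⟨ ℕ.*-assoc (ℓ * g + b) ((ℓ * g + b) ^ n) 1 ⟨
  (ℓ * g + b) * (ℓ * g + b) ^ n * 1 ∎
  where
  open ℕ.≤-Reasoning
  G = mostly good bad n zero
  g = length good
  b = length bad
  lhs : ∀ g G ℓ p → g * G * (ℓ * p) ≡ ℓ * g * (G * p)
  lhs = solve-∀
length-mostly ℓ good bad (suc n) (suc x) = begin
  length (cartesianProductWith _∷_ good G ++ cartesianProductWith _∷_ bad B) * (ℓ * ℓ ^ n)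
    ≡⟨ cong (_* (ℓ * ℓ ^ n)) (trans (length-++ (cartesianProductWith _∷_ good G))
         (cong₂ _+_ (length-cartesianProductWith _∷_ good G) (length-cartesianProductWith _∷_ bad B))) ⟩
  (g * length G + b * length B) * (ℓ * ℓ ^ n)
    ≡⟨ lhs g b (length G) (length B) ℓ (ℓ ^ n) ⟩
  ℓ * g * (length G * ℓ ^ n) + b * ℓ * (length B * ℓ ^ n)
    ≤⟨ ℕ.+-mono-≤ (ℕ.*-monoʳ-≤ (ℓ * g) (length-mostly ℓ good bad n (suc x)))
                  (ℕ.*-monoʳ-≤ (b * ℓ) (length-mostly ℓ good bad n x)) ⟩
  ℓ * g * (w ^ n * (ℓ * ℓ ^ x)) + b * ℓ * (w ^ n * ℓ ^ x)
    ≡⟨ rhs g b ℓ (w ^ n) (ℓ ^ x) ⟩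
  w * w ^ n * (ℓ * ℓ ^ x) ∎
  where
  open ℕ.≤-Reasoning
  G = mostly good bad n (suc x)
  B = mostly good bad n x
  g = length good
  b = length bad
  w = ℓ * g + b
  lhs : ∀ g b G B ℓ p → (g * G + b * B) * (ℓ * p) ≡ ℓ * g * (G * p) + b * ℓ * (B * p)
  lhs = solve-∀
  rhs : ∀ g b ℓ p q → ℓ * g * (p * (ℓ * q)) + b * ℓ * (p * q) ≡ (ℓ * g + b) * p * (ℓ * q)
  rhs = solve-∀

-- With the weight `ℓ = length bad` the base of the power is `suc g * b`, so that `b ^ n` cancels.
length-mostly′ : ∀ (good bad : List X) .{{_ : NonZero (length bad)}} n x →
  length (mostly good bad n x) ≤ suc (length good) ^ n * length bad ^ x
length-mostly′ good bad n x = ℕ.*-cancelʳ-≤ _ _ (b ^ n) {{ℕ.m^n≢0 b n}} (begin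
  length (mostly good bad n x) * b ^ n  ≤⟨ length-mostly b good bad n x ⟩
  (b * g + b) ^ n * b ^ x               ≡⟨ cong (λ w → w ^ n * b ^ x) weight ⟩
  (suc g * b) ^ n * b ^ x               ≡⟨ cong (_* b ^ x) (^-distribʳ-* (suc g) b n) ⟩
  suc g ^ n * b ^ n * b ^ x             ≡⟨ rearrange (suc g ^ n) (b ^ n) (b ^ x) ⟩
  suc g ^ n * b ^ x * b ^ n             ∎)
  where
  open ℕ.≤-Reasoning
  g = length good
  b = length bad
  weight : b * g + b ≡ suc g * b
  weight = trans (ℕ.+-comm (b * g) b) (trans (sym (ℕ.*-suc b g)) (ℕ.*-comm b (suc g)))
  rearrange : ∀ p q r → p * q * r ≡ p * r * q
  rearrange = solve-∀

lists : List X → ℕ → List (List X)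
lists xs zero    = [] ∷ []
lists xs (suc n) = cartesianProductWith _∷_ xs (lists xs n)

length-lists : ∀ (xs : List X) n → length (lists xs n) ≡ length xs ^ n
length-lists xs zero    = refl
length-lists xs (suc n) =
  trans (length-cartesianProductWith _∷_ xs (lists xs n)) (cong (length xs *_) (length-lists xs n))

∈-lists : ∀ {xs : List X} ys → All (_∈ xs) ys → ys ∈ lists xs (length ys)
∈-lists []       _        = here refl
∈-lists (y ∷ ys) (p ∷ ps) = ∈-cartesianProductWith⁺ _∷_ p (∈-lists ys ps)

rowsOf : ℕ → List (List Bool)
rowsOf = lists (false ∷ true ∷ [])

∈-rowsOf : ∀ bs → bs ∈ rowsOf (length bs)
∈-rowsOf bs = ∈-lists bs (All.universal bool∈ bs)
  where
  bool∈ : ∀ b → b ∈ false ∷ true ∷ []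
  bool∈ false = here refl
  bool∈ true  = there (here refl)

someIn : List X → List X → ℕ → List (List X)
someIn good all zero    = []
someIn good all (suc k) = cartesianProductWith _∷_ good (lists all k)
                       ++ cartesianProductWith _∷_ all (someIn good all k)

-- A union bound over the position of the entry taken from `good`; repetitions in the enumeration
-- are harmless.
length-someIn : ∀ (good all : List X) k →
  length (someIn good all (suc k)) ≤ suc k * (length good * length all ^ k)
length-someIn good all k = begin
  length (someIn good all (suc k))
    ≡⟨ trans (length-++ (cartesianProductWith _∷_ good (lists all k)))
         (cong₂ _+_ (trans (length-cartesianProductWith _∷_ good _) (cong (g *_) (length-lists all k)))
                    (length-cartesianProductWith _∷_ all _)) ⟩
  g * a ^ k + a * length (someIn good all k)
    ≤⟨ ℕ.+-monoʳ-≤ (g * a ^ k) (step k) ⟩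
  g * a ^ k + k * (g * a ^ k) ∎
  where
  open ℕ.≤-Reasoning
  g = length good
  a = length all
  rearrange : ∀ a k g p → a * (k * (g * p)) ≡ k * (g * (a * p))
  rearrange = solve-∀
  step : ∀ k → a * length (someIn good all k) ≤ k * (g * a ^ k)
  step zero    = ℕ.≤-reflexive (ℕ.*-zeroʳ a)
  step (suc k) = begin
    a * length (someIn good all (suc k)) ≤⟨ ℕ.*-monoʳ-≤ a (length-someIn good all k) ⟩
    a * (suc k * (g * a ^ k))            ≡⟨ rearrange a (suc k) g (a ^ k) ⟩
    suc k * (g * (a * a ^ k))            ∎

∈-someIn : ∀ {Q : Pred X 0ℓ} {good all : List X} {ys} → All (λ y → (Q y → y ∈ good) × y ∈ all) ys →
           Any Q ys → ys ∈ someIn good all (length ys)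
∈-someIn ((g , _) ∷ ps) (here q)  =
  ∈-++⁺ˡ (∈-cartesianProductWith⁺ _∷_ (g q) (∈-lists _ (All.map proj₂ ps)))
∈-someIn {good = good} {all} {y ∷ ys} ((_ , a) ∷ ps) (there q) =
  ∈-++⁺ʳ (cartesianProductWith _∷_ good (lists all (length ys))) (∈-cartesianProductWith⁺ _∷_ a (∈-someIn ps q))

Few : ℕ → Pred (List Bool) 0ℓ
Few M bs = length (filter T? bs) ≤ M

fewTrue : ℕ → ℕ → List (List Bool)
fewTrue M m = mostly (false ∷ []) (true ∷ []) m M

∈-fewTrue : ∀ M bs → Few M bs → bs ∈ fewTrue M (length bs)
∈-fewTrue M bs = ∈-mostly T? M bs (All.universal entry bs)
  where
  entry : ∀ b → (¬ T b → b ∈ false ∷ []) × (T b → b ∈ true ∷ [])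
  entry false = (λ _ → here refl) , λ ()
  entry true  = (λ ¬t → contradiction _ ¬t) , λ _ → here refl

-- (8 / 7) ^ 5 ≤ 2 saves a constant factor in the exponent.
length-fewTrue : ∀ M j → length (fewTrue M (5 * j)) ≤ 2 ^ (3 * M + j)
length-fewTrue M j = ℕ.*-cancelʳ-≤ _ _ (7 ^ m) {{ℕ.m^n≢0 7 m}} (begin
  length (fewTrue M m) * 7 ^ m    ≤⟨ length-mostly 7 (false ∷ []) (true ∷ []) m M ⟩
  8 ^ m * 7 ^ M                   ≡⟨ cong (_* 7 ^ M) (ℕ.^-*-assoc 8 5 j) ⟨
  (8 ^ 5) ^ j * 7 ^ M             ≤⟨ ℕ.*-mono-≤ (ℕ.^-monoˡ-≤ j (ℕ.≤ᵇ⇒≤ (8 ^ 5) (2 * 7 ^ 5) _))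
                                                (ℕ.^-monoˡ-≤ M (ℕ.≤ᵇ⇒≤ 7 8 _)) ⟩
  (2 * 7 ^ 5) ^ j * (2 ^ 3) ^ M   ≡⟨ cong₂ _*_ (^-distribʳ-* 2 (7 ^ 5) j) (ℕ.^-*-assoc 2 3 M) ⟩
  2 ^ j * (7 ^ 5) ^ j * 2 ^ (3 * M) ≡⟨ cong (λ z → 2 ^ j * z * 2 ^ (3 * M)) (ℕ.^-*-assoc 7 5 j) ⟩
  2 ^ j * 7 ^ m * 2 ^ (3 * M)     ≡⟨ rearrange (2 ^ j) (7 ^ m) (2 ^ (3 * M)) ⟩
  2 ^ (3 * M) * 2 ^ j * 7 ^ m     ≡⟨ cong (_* 7 ^ m) (ℕ.^-distribˡ-+-* 2 (3 * M) j) ⟨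
  2 ^ (3 * M + j) * 7 ^ m         ∎)
  where
  open ℕ.≤-Reasoning
  m = 5 * j
  rearrange : ∀ p q r → p * q * r ≡ r * p * q
  rearrange = solve-∀

-- Encoding graphs by removing structured subgraphs

Rows : Set
Rows = List (List Bool)

module _ {N : ℕ} (G : Graph N) where

  -- The strict upper triangle of the adjacency matrix, with the vertices in the order of `L`.
  rows : List (Fin N) → Rows
  rows []      = []
  rows (x ∷ L) = map (adj G x) L ∷ rows L

  type : List (List (Fin N)) → Fin N → List (List Bool)
  type Ps v = map (map (adj G v)) Ps

glue : Rows → List (List (List Bool)) → Rows → Rows
glue rs ts rs′ = zipWith _++_ rs (map concat ts) ++ rs′

-- With the removed parts put last, a vertex of `R` only has its type appended to its row.
rows-++ : ∀ {N} (G : Graph N) R Ps →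
          rows G (R ++ concat Ps) ≡ glue (rows G R) (map (type G Ps) R) (rows G (concat Ps))
rows-++ G []      Ps = refl
rows-++ G (v ∷ R) Ps = cong₂ _∷_
  (trans (map-++ (adj G v) R (concat Ps)) (cong (map (adj G v) R ++_) (sym (concat-map Ps))))
  (rows-++ G R Ps)

triangles : ℕ → List Rows
triangles zero    = [] ∷ []
triangles (suc n) = cartesianProductWith _∷_ (rowsOf n) (triangles n)

∈-triangles : ∀ {N} (G : Graph N) L → rows G L ∈ triangles (length L)
∈-triangles G []      = here refl
∈-triangles G (x ∷ L) = ∈-cartesianProductWith⁺ _∷_
  (subst (λ n → map (adj G x) L ∈ rowsOf n) (length-map (adj G x) L) (∈-rowsOf (map (adj G x) L)))
  (∈-triangles G L)

length-rowsOf : ∀ n → length (rowsOf n) ≡ 2 ^ n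
length-rowsOf = length-lists (false ∷ true ∷ [])

length-lists-rowsOf : ∀ m k → length (lists (rowsOf m) k) ≡ 2 ^ (m * k)
length-lists-rowsOf m k = trans (length-lists (rowsOf m) k)
  (trans (cong (_^ k) (length-rowsOf m)) (ℕ.^-*-assoc 2 m k))

-- A crude exponent is enough, since this is applied only to vertex sets of bounded size.
length-triangles : ∀ n → length (triangles n) ≤ 2 ^ (n * n)
length-triangles zero    = s≤s z≤n
length-triangles (suc n) = begin
  length (triangles (suc n))                ≡⟨ length-cartesianProductWith _∷_ (rowsOf n) (triangles n) ⟩
  length (rowsOf n) * length (triangles n)  ≤⟨ ℕ.*-mono-≤ (ℕ.≤-reflexive (length-rowsOf n)) (length-triangles n) ⟩
  2 ^ n * 2 ^ (n * n)                       ≡⟨ ℕ.^-distribˡ-+-* 2 n (n * n) ⟨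
  2 ^ (n + n * n)                           ≤⟨ ℕ.^-monoʳ-≤ 2 (ℕ.*-monoʳ-≤ (suc n) (ℕ.n≤1+n n)) ⟩
  2 ^ (suc n * suc n)                       ∎
  where open ℕ.≤-Reasoning

GraphClass : Set₁
GraphClass = ∀ {N} → Graph N → List (Fin N) → Set

-- The vertices are listed in a suitable order, so graphs are only encoded up to isomorphism.
CodedBy : GraphClass → ℕ → List Rows → Set
CodedBy Class n xs = ∀ {N} (G : Graph N) L → Unique L → length L ≡ n → Class G L →
                     ∃[ L′ ] L′ ↭ L × rows G L′ ∈ xs

-- (A n² + O(n)) / D bits suffice.
Bounded : (D A : ℕ) → GraphClass → Set
Bounded D A Class = ∃[ B ] ∃[ C ] ∀ n → ∃[ xs ]
  length xs ^ D ≤ 2 ^ (A * (n * n) + B * n + C) × CodedBy Class n xs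

-- A removal that is cheap to undo: apart from `x` exceptions, the type of a remaining vertex has a
-- row in `Q`, which leaves few types to choose from.
record Split {N} (k m x : ℕ) {Q : Pred (List Bool) 0ℓ} (Q? : Decidable Q) (Class : GraphClass)
             (G : Graph N) (L : List (Fin N)) : Set where
  field
    parts   : List (List (Fin N))
    rest    : List (Fin N)
    split   : L ↭ rest ++ concat parts
    #parts  : length parts ≡ k
    sizes   : All (λ P → length P ≡ m) parts
    inClass : Class G rest
    mostQ   : length (filter (¬? ∘ any? Q?) (map (type G parts) rest)) ≤ x

length-concat : ∀ {X : Set} {m} {Ps : List (List X)} → All (λ P → length P ≡ m) Ps →
                length (concat Ps) ≡ length Ps * m
length-concat []                    = refl
length-concat {Ps = P ∷ Ps} (p ∷ ps) = trans (length-++ P) (cong₂ _+_ p (length-concat ps))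

module _ {X : Set} where

  Unique-↭ : ∀ {xs ys : List X} → xs ↭ ys → Unique xs → Unique ys
  Unique-↭ p = ↭ₛ.Unique-resp-↭ (setoid X) (↭⇒↭ₛ p)

  Unique-++⁻ˡ : ∀ (xs : List X) {ys} → Unique (xs ++ ys) → Unique xs
  Unique-++⁻ˡ []       _        = []
  Unique-++⁻ˡ (x ∷ xs) (p ∷ ps) = All.++⁻ˡ xs p ∷ Unique-++⁻ˡ xs ps

type-rows : ∀ {N m} (G : Graph N) {Ps} → All (λ P → length P ≡ m) Ps → ∀ v →
            All (λ bs → length bs ≡ m × bs ∈ rowsOf m) (type G Ps v)
type-rows G sizes v = All.map⁺ (All.map (λ {P} size →
  let size′ = trans (length-map (adj G v) P) size
  in size′ , subst (λ n → map (adj G v) P ∈ rowsOf n) size′ (∈-rowsOf _)) sizes)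

type∈lists : ∀ {N m k} (G : Graph N) {Ps} → All (λ P → length P ≡ m) Ps → length Ps ≡ k → ∀ v →
             type G Ps v ∈ lists (rowsOf m) k
type∈lists G {Ps} sizes #Ps v =
  subst (λ l → type G Ps v ∈ lists _ l) (trans (length-map (map (adj G v)) Ps) #Ps)
    (∈-lists _ (All.map proj₂ (type-rows G sizes v)))

-- The sum is at most twice the maximum, and the factor 2 becomes `D` in the exponent.
sum-bound : ∀ D {a b} e f {g} → a ^ D ≤ 2 ^ e → b ^ D ≤ 2 ^ f → D + e ≤ g → D + f ≤ g →
            (a + b) ^ D ≤ 2 ^ g
sum-bound D {a} {b} e f {g} a≤ b≤ e≤ f≤ = begin
  (a + b) ^ D            ≤⟨ ℕ.^-monoˡ-≤ D (ℕ.+-mono-≤ (ℕ.m≤m⊔n a b) (ℕ.m≤n⊔m a b)) ⟩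
  (a ⊔ b + (a ⊔ b)) ^ D  ≡⟨ cong (λ z → (a ⊔ b + z) ^ D) (sym (ℕ.+-identityʳ (a ⊔ b))) ⟩
  (2 * (a ⊔ b)) ^ D      ≡⟨ ^-distribʳ-* 2 (a ⊔ b) D ⟩
  2 ^ D * (a ⊔ b) ^ D    ≤⟨ max≤ (ℕ.⊔-sel a b) ⟩
  2 ^ g                  ∎
  where
  open ℕ.≤-Reasoning
  double : ∀ {c} e → c ^ D ≤ 2 ^ e → D + e ≤ g → 2 ^ D * c ^ D ≤ 2 ^ g
  double {c} e c≤ e≤ = begin
    2 ^ D * c ^ D  ≤⟨ ℕ.*-monoʳ-≤ (2 ^ D) c≤ ⟩
    2 ^ D * 2 ^ e  ≡⟨ ℕ.^-distribˡ-+-* 2 D e ⟨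
    2 ^ (D + e)    ≤⟨ ℕ.^-monoʳ-≤ 2 e≤ ⟩
    2 ^ g          ∎
  max≤ : a ⊔ b ≡ a ⊎ a ⊔ b ≡ b → 2 ^ D * (a ⊔ b) ^ D ≤ 2 ^ g
  max≤ (inj₁ eq) = subst (λ z → 2 ^ D * z ^ D ≤ 2 ^ g) (sym eq) (double e a≤ e≤)
  max≤ (inj₂ eq) = subst (λ z → 2 ^ D * z ^ D ≤ 2 ^ g) (sym eq) (double f b≤ f≤)

product-bound : ∀ D {a b} e f → a ^ D ≤ 2 ^ e → b ^ D ≤ 2 ^ f → (a * b) ^ D ≤ 2 ^ (e + f)
product-bound D {a} {b} e f a≤ b≤ =
  subst₂ _≤_ (sym (^-distribʳ-* a b D)) (sym (ℕ.^-distribˡ-+-* 2 e f)) (ℕ.*-mono-≤ a≤ b≤)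

power-bound : ∀ D {a} e → a ≤ 2 ^ e → a ^ D ≤ 2 ^ (e * D)
power-bound D {a} e a≤ = subst (a ^ D ≤_) (ℕ.^-*-assoc 2 e D) (ℕ.^-monoˡ-≤ D a≤)

iterate-bound : ∀ D n {a} τ → a ^ D ≤ 2 ^ τ → (a ^ n) ^ D ≤ 2 ^ (τ * n)
iterate-bound D n {a} τ a≤ = begin
  (a ^ n) ^ D  ≡⟨ trans (ℕ.^-*-assoc a n D) (trans (cong (a ^_) (ℕ.*-comm n D)) (sym (ℕ.^-*-assoc a D n))) ⟩
  (a ^ D) ^ n  ≤⟨ ℕ.^-monoˡ-≤ n a≤ ⟩
  (2 ^ τ) ^ n  ≡⟨ ℕ.^-*-assoc 2 τ n ⟩
  2 ^ (τ * n)  ∎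
  where open ℕ.≤-Reasoning

-- Passes a bound from `Lower` to `Class` if every graph in `Class` lies in `Lower` or splits. A
-- remaining vertex costs `τ` in the exponent; adding `k * m` vertices makes `A * (n * n)` grow by
-- at least `2 * A * (k * m)` for each of the `n` remaining ones.
module Stage
  (D A k m x τ : ℕ) .{{_ : NonZero (k * m)}}
  {Q : Pred (List Bool) 0ℓ} (Q? : Decidable Q) (good : List (List Bool))
  (∈-good : ∀ bs → length bs ≡ m → Q bs → bs ∈ good)
  (types≤ : suc (length (someIn good (rowsOf m) k)) ^ D ≤ 2 ^ τ)
  (τ≤ : τ ≤ 2 * A * (k * m))
  where

  private
    s : ℕ
    s = k * m

    goodTypes allTypes : List (List (List Bool))
    goodTypes = someIn good (rowsOf m) k
    allTypes  = lists (rowsOf m) k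

    length-allTypes : length allTypes ≡ 2 ^ (m * k)
    length-allTypes = length-lists-rowsOf m k

    instance
      allTypes≢0 : NonZero (length allTypes)
      allTypes≢0 = subst NonZero (sym length-allTypes) (ℕ.m^n≢0 2 (m * k))

    extensions : ℕ → List Rows → List Rows
    extensions n xs = cartesianProductWith (λ rs f → f rs) xs
      (cartesianProductWith (λ ts rs′ rs → glue rs ts rs′) (mostly goodTypes allTypes n x) (triangles s))

    -- The cost that does not grow with `n`: arbitrary types for the `x` exceptions, and the edges
    -- within the removed set.
    overhead : ℕ
    overhead = m * k * x * D + s * s * D

    length-extensions : ∀ n xs e → length xs ^ D ≤ 2 ^ e →
                        length (extensions n xs) ^ D ≤ 2 ^ (e + (τ * n + overhead))
    length-extensions n xs e xs≤ = subst (λ l → l ^ D ≤ 2 ^ (e + (τ * n + overhead))) (sym length≡)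
      (product-bound D e (τ * n + overhead) xs≤
        (subst (λ z → (length ts * length (triangles s)) ^ D ≤ 2 ^ z)
          (ℕ.+-assoc (τ * n) (m * k * x * D) (s * s * D))
          (product-bound D (τ * n + m * k * x * D) (s * s * D) ts≤
            (power-bound D (s * s) (length-triangles s)))))
      where
      ts = mostly goodTypes allTypes n x
      length≡ : length (extensions n xs) ≡ length xs * (length ts * length (triangles s))
      length≡ = trans (length-cartesianProductWith (λ rs f → f rs) xs _)
        (cong (length xs *_) (length-cartesianProductWith _ ts (triangles s)))
      ts≤ : length ts ^ D ≤ 2 ^ (τ * n + m * k * x * D)
      ts≤ = ℕ.≤-trans (ℕ.^-monoˡ-≤ D (length-mostly′ goodTypes allTypes n x))
        (product-bound D (τ * n) (m * k * x * D) (iterate-bound D n τ types≤) (power-bound D (m * k * x)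
          (ℕ.≤-reflexive (trans (cong (_^ x) length-allTypes) (ℕ.^-*-assoc 2 (m * k) x)))))

    module _ {Class : GraphClass} {n xs} (coded : CodedBy Class n xs) where

      ∈-extensions : ∀ {N} (G : Graph N) L → Unique L → length L ≡ n + s → Split k m x Q? Class G L →
                     ∃[ L′ ] L′ ↭ L × rows G L′ ∈ extensions n xs
      ∈-extensions G L L! |L|≡ sp =
        extend (coded G rest (Unique-++⁻ˡ rest (Unique-↭ split L!)) |rest|≡ inClass)
        where
        open Split sp

        |concat|≡ : length (concat parts) ≡ s
        |concat|≡ = trans (length-concat sizes) (cong (_* m) #parts)

        |rest|≡ : length rest ≡ n
        |rest|≡ = ℕ.+-cancelʳ-≡ s (length rest) n (begin
          length rest + s                     ≡⟨ cong (length rest +_) |concat|≡ ⟨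
          length rest + length (concat parts) ≡⟨ length-++ rest ⟨
          length (rest ++ concat parts)       ≡⟨ ↭-length split ⟨
          length L                            ≡⟨ |L|≡ ⟩
          n + s                               ∎)
          where open ≡-Reasoning

        type∈ : ∀ v → let t = type G parts v in
                (¬ ¬ Any Q t → t ∈ goodTypes) × (¬ Any Q t → t ∈ allTypes)
        type∈ v =
          (λ q → subst (λ l → t ∈ someIn good (rowsOf m) l) |t|≡
                   (∈-someIn (All.map (λ (size , row) → ∈-good _ size , row) (type-rows G sizes v))
                     (decidable-stable (any? Q? t) q))) ,
          (λ _ → type∈lists G sizes #parts v)
          where
          t = type G parts v
          |t|≡ : length t ≡ k
          |t|≡ = trans (length-map (map (adj G v)) parts) #parts

        extend : (∃[ R′ ] R′ ↭ rest × rows G R′ ∈ xs) → ∃[ L′ ] L′ ↭ L × rows G L′ ∈ extensions n xs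
        extend (R′ , R′↭ , r) =
          R′ ++ concat parts , ↭-trans (↭-++⁺ʳ (concat parts) R′↭) (↭-sym split) ,
          subst (_∈ extensions n xs) (sym (rows-++ G R′ parts))
            (∈-cartesianProductWith⁺ _ r (∈-cartesianProductWith⁺ _ types∈
              (subst (λ l → rows G (concat parts) ∈ triangles l) |concat|≡ (∈-triangles G (concat parts)))))
          where
          types∈ : map (type G parts) R′ ∈ mostly goodTypes allTypes n x
          types∈ = subst (λ l → map (type G parts) R′ ∈ mostly goodTypes allTypes l x)
            (trans (length-map (type G parts) R′) (trans (↭-length R′↭) |rest|≡))
            (∈-mostly (¬? ∘ any? Q?) x (map (type G parts) R′) (All.map⁺ (All.universal type∈ R′))
              (subst (_≤ x) (↭-length (filter-↭ (¬? ∘ any? Q?) (↭-map⁺ (type G parts) (↭-sym R′↭)))) mostQ))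

  module _
    {Class Lower : GraphClass}
    (lower⊎split : ∀ {N} (G : Graph N) L → Unique L → Class G L → Lower G L ⊎ Split k m x Q? Class G L)
    (bounded : Bounded D A Lower)
    where

    private
      B C : ℕ
      -- `sum-bound` charges `D` for joining two codes. The summand in `C` pays it for the code of
      -- `Lower`; the summand in `B` pays it together with `overhead` at each removal, as `s` is
      -- nonzero.
      B = proj₁ bounded + (D + overhead)
      C = proj₁ (proj₂ bounded) + D

      bound : ℕ → ℕ
      bound n = A * (n * n) + B * n + C

      lowerBound : ℕ → ℕ
      lowerBound n = A * (n * n) + proj₁ bounded * n + proj₁ (proj₂ bounded)

      lower : ∀ n → ∃[ xs ] (length xs ^ D ≤ 2 ^ lowerBound n
                             × CodedBy Lower n xs)
      lower = proj₂ (proj₂ bounded)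

      lower≤ : ∀ n → D + lowerBound n ≤ bound n
      lower≤ n = ℕ.≤-trans (ℕ.m≤m+n _ ((D + overhead) * n))
        (ℕ.≤-reflexive (eq D A (n * n) (proj₁ bounded) (D + overhead) n (proj₁ (proj₂ bounded))))
        where
        eq : ∀ D A n² B′ K n C′ → D + (A * n² + B′ * n + C′) + K * n ≡ A * n² + (B′ + K) * n + (C′ + D)
        eq = solve-∀

      step≤ : ∀ n → D + (bound n + (τ * n + overhead)) ≤ bound (n + s)
      step≤ n = begin
        D + (bound n + (τ * n + overhead))
          ≤⟨ ℕ.+-monoʳ-≤ D (ℕ.+-monoʳ-≤ (bound n) (ℕ.+-monoˡ-≤ overhead (ℕ.*-monoˡ-≤ n τ≤))) ⟩
        D + (bound n + (2 * A * s * n + overhead))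
          ≡⟨ eq₁ D (bound n) (2 * A * s * n) overhead ⟩
        bound n + 2 * A * s * n + (D + overhead)
          ≤⟨ ℕ.+-monoʳ-≤ (bound n + 2 * A * s * n)
               (ℕ.≤-trans (ℕ.m≤n+m (D + overhead) (proj₁ bounded)) (ℕ.m≤m*n B s)) ⟩
        bound n + 2 * A * s * n + B * s
          ≤⟨ ℕ.m≤m+n _ (A * (s * s)) ⟩
        bound n + 2 * A * s * n + B * s + A * (s * s)
          ≡⟨ eq₂ A B C s n ⟩
        bound (n + s) ∎
        where
        open ℕ.≤-Reasoning
        eq₁ : ∀ D b t o → D + (b + (t + o)) ≡ b + t + (D + o)
        eq₁ = solve-∀
        eq₂ : ∀ A B C s n → A * (n * n) + B * n + C + 2 * A * s * n + B * s + A * (s * s)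
                          ≡ A * ((n + s) * (n + s)) + B * (n + s) + C
        eq₂ = solve-∀

      Code : ℕ → Set
      Code n = ∃[ xs ] length xs ^ D ≤ 2 ^ bound n × CodedBy Class n xs

      -- The parts of a split alone have `s` vertices, so for `n < s` only `Lower` occurs.
      code-small : ∀ n → n < s → Code n
      code-small n n<s = let xs , xs≤ , coded = lower n in
        xs , ℕ.≤-trans xs≤ (ℕ.^-monoʳ-≤ 2 (ℕ.≤-trans (ℕ.m≤n+m _ D) (lower≤ n))) ,
        λ G L L! |L|≡n c → small G L L! |L|≡n (lower⊎split G L L! c) coded
        where
        small : ∀ {N} (G : Graph N) L → Unique L → length L ≡ n → Lower G L ⊎ Split k m x Q? Class G L →
                ∀ {xs} → CodedBy Lower n xs → ∃[ L′ ] L′ ↭ L × rows G L′ ∈ xs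
        small G L L! |L|≡n (inj₁ l)  coded = coded G L L! |L|≡n l
        small G L L! |L|≡n (inj₂ sp) coded = contradiction (begin-strict
          n                                   <⟨ n<s ⟩
          s                                   ≡⟨ trans (length-concat sizes) (cong (_* m) #parts) ⟨
          length (concat parts)               ≤⟨ ℕ.m≤n+m _ (length rest) ⟩
          length rest + length (concat parts) ≡⟨ length-++ rest ⟨
          length (rest ++ concat parts)       ≡⟨ ↭-length split ⟨
          length L                            ≡⟨ |L|≡n ⟩
          n                                   ∎) (ℕ.<-irrefl refl)
          where
          open Split sp
          open ℕ.≤-Reasoning

      code-step : ∀ n → Code n → Code (n + s)
      code-step n (xs , xs≤ , coded) = let ys , ys≤ , coded′ = lower (n + s) in
        ys ++ extensions n xs ,
        subst (λ l → l ^ D ≤ 2 ^ bound (n + s)) (sym (length-++ ys)) 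
          (sum-bound D (lowerBound (n + s)) (bound n + (τ * n + overhead)) ys≤
            (length-extensions n xs (bound n) xs≤) (lower≤ (n + s)) (step≤ n)) ,
        λ G L L! |L|≡ c → join G L L! |L|≡ (lower⊎split G L L! c) coded′
        where
        join : ∀ {N} (G : Graph N) L → Unique L → length L ≡ n + s → Lower G L ⊎ Split k m x Q? Class G L →
               ∀ {ys} → CodedBy Lower (n + s) ys → ∃[ L′ ] L′ ↭ L × rows G L′ ∈ ys ++ extensions n xs
        join G L L! |L|≡ (inj₁ l)  coded′ =
          let L′ , L′↭ , r = coded′ G L L! |L|≡ l in L′ , L′↭ , ∈-++⁺ˡ r
        join G L L! |L|≡ (inj₂ sp) {ys} _ =
          let L′ , L′↭ , r = ∈-extensions {Class} {n} {xs} coded G L L! |L|≡ sp in L′ , L′↭ , ∈-++⁺ʳ ys r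

      code : ∀ n → Acc _<_ n → Code n
      code n (acc rec) with s ℕ.≤? n
      ... | no  s≰n = code-small n (ℕ.≰⇒> s≰n)
      ... | yes s≤n = subst Code (ℕ.m∸n+n≡m s≤n)
        (code-step (n ∸ s) (code (n ∸ s) (rec (ℕ.∸-monoʳ-< (>-nonZero⁻¹ s) s≤n))))

    stage : Bounded D A Class
    stage = B , C , λ n → code n (<-wellFounded n)

-- Complete multipartite subgraphs

module _ {X : Set} {P : Pred X 0ℓ} (P? : Decidable P) where

  length-filter-map : ∀ {Y : Set} (f : Y → X) ys →
                      length (filter P? (map f ys)) ≡ length (filter (P? ∘ f) ys)
  length-filter-map f []       = refl
  length-filter-map f (y ∷ ys) with P? (f y)
  ... | yes _ = cong suc (length-filter-map f ys)
  ... | no  _ = length-filter-map f ys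

  length-filter-¬ : ∀ xs → length (filter P? xs) + length (filter (¬? ∘ P?) xs) ≡ length xs
  length-filter-¬ []       = refl
  length-filter-¬ (x ∷ xs) with P? x
  ... | yes _ = cong suc (length-filter-¬ xs)
  ... | no  _ = trans (ℕ.+-suc _ _) (cong suc (length-filter-¬ xs))

length-take≡ : ∀ {X : Set} n (xs : List X) → n ≤ length xs → length (take n xs) ≡ n
length-take≡ n xs n≤ = trans (length-take n xs) (ℕ.m≤n⇒m⊓n≡m n≤)

module _ {X Y : Set} (_≟_ : DecidableEquality Y) (f : X → Y) (M : ℕ) where

  -- Pigeonhole, one value at a time: a value taken at most `M` times is dropped together with its
  -- elements, which preserves the inequality.
  fibre : ∀ ts xs → Unique xs → All (λ x → f x ∈ ts) xs → M * length ts < length xs →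
          ∃[ t ] ∃[ W ] M < length W × Unique W × All (λ w → f w ≡ t) W × All (_∈ xs) W
  fibre []       (x ∷ xs) _ (() ∷ _) _
  fibre []       []       _ _ many = contradiction many λ ()
  fibre (t ∷ ts) xs xs! f∈ many with M ℕ.<? length (filter (λ x → f x ≟ t) xs)
  ... | yes M< = t , filter (λ x → f x ≟ t) xs , M< , Unique.filter⁺ _ xs! , All.all-filter _ xs ,
                 All.filter⁺ _ (All.tabulate id)
  ... | no  M≮ =
    let t′ , W , M< , W! , eq , W⊆ = fibre ts others (Unique.filter⁺ _ xs!)
          (All.map (λ { (f∈ , ≢t) → tail f∈ ≢t }) (All.zip (All.filter⁺ _ f∈ , All.all-filter _ xs))) fewer
    in t′ , W , M< , W! , eq , All.map (All.lookup (All.filter⁺ _ (All.tabulate id))) W⊆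
    where
    eq? = λ x → f x ≟ t
    others = filter (¬? ∘ eq?) xs
    tail : ∀ {y} → y ∈ t ∷ ts → y ≢ t → y ∈ ts
    tail (here y≡t) y≢t = contradiction y≡t y≢t
    tail (there y∈) _   = y∈
    fewer : M * length ts < length others
    fewer = ℕ.+-cancelˡ-< M _ _ (begin-strict
      M + M * length ts                          ≡⟨ ℕ.*-suc M (length ts) ⟨
      M * length (t ∷ ts)                        <⟨ many ⟩
      length xs                                  ≡⟨ length-filter-¬ eq? xs ⟨
      length (filter eq? xs) + length others     ≤⟨ ℕ.+-monoˡ-≤ _ (ℕ.≮⇒≥ M≮) ⟩
      M + length others                          ∎)
      where open ℕ.≤-Reasoning

complement : ∀ {X : Set} {L : List X} S → Unique S → All (_∈ L) S → ∃[ R ] L ↭ R ++ S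
complement {L = L} [] _ _ = L , ↭-reflexive (sym (++-identityʳ L))
complement {L = L} (x ∷ S) (x≢S ∷ S!) (x∈L ∷ S⊆L) with complement S S! S⊆L
... | R , L↭ with ∈-++⁻ R (∈-resp-↭ L↭ x∈L)
...   | inj₂ x∈S = contradiction refl (All.lookup x≢S x∈S)
...   | inj₁ x∈R with ys , zs , refl ← ∈-∃++ x∈R =
  ys ++ zs , ↭-trans L↭ (↭-trans (↭-++⁺ʳ S (shift x ys zs)) (↭-sym (shift x (ys ++ zs) S)))

Cross : ∀ {X : Set} → (X → X → Set) → List X → List X → Set
Cross R P P′ = All (λ p → All (R p) P′) P

Cross-flip : ∀ {X : Set} {R : X → X → Set} {P P′} → Cross R P P′ → Cross (λ x y → R y x) P′ P
Cross-flip c = All.tabulate λ q∈ → All.tabulate λ p∈ → All.lookup (All.lookup c p∈) q∈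

-- For R = Adjacent G these are the parts of a complete multipartite subgraph that is not
-- necessarily induced: there may be further edges inside the parts.
record Family {X : Set} (R : X → X → Set) (E : Pred X 0ℓ) (Ps : List (List X)) : Set where
  constructor family
  field
    cross  : AllPairs (Cross R) Ps
    unique : All Unique Ps
    inside : All (All E) Ps

open Family public

module _ {N : ℕ} (G : Graph N) where

  Multipartite : List (Fin N) → List (List (Fin N)) → Set
  Multipartite L = Family (Adjacent G) (_∈ L)

  multipartite? : ∀ L Ps → Dec (Multipartite L Ps)
  multipartite? L Ps = map′ (λ (c , u , i) → family c u i) (λ p → cross p , unique p , inside p)
    (allPairs? (λ P P′ → all? (λ p → all? (λ q → T? (adj G p q)) P′) P) Ps ×-dec
     all? (UniqueDec.unique? _≟_) Ps ×-dec
     all? (all? (λ p → any? (p ≟_) L)) Ps)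

  Contains : (k m : ℕ) → List (Fin N) → Set
  Contains k m L = ∃[ Ps ] (length Ps ≡ k × All (λ P → length P ≡ m) Ps) × Multipartite L Ps

  contains? : ∀ k m L → Dec (Contains k m L)
  contains? k m L = map′ satisfied
    (λ { (Ps , p@((refl , sizes) , _)) →
      lose (∈-lists Ps (All.map (λ { refl → ∈-lists _ (All.universal ∈-allFin _) }) sizes)) p })
    (any? (λ Ps → (length Ps ℕ.≟ k ×-dec all? (λ P → length P ℕ.≟ m) Ps) ×-dec multipartite? L Ps)
      (lists (lists (allFin N) m) k))

  irrefl : ∀ x → ¬ Adjacent G x x
  irrefl x = subst T (adj-irrefl G x)

  adjacent-sym : ∀ {x y} → Adjacent G x y → Adjacent G y x
  adjacent-sym {x} {y} = subst T (adj-sym G x y)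

  -- A common vertex of two parts would be adjacent to itself, so the parts are disjoint and can be
  -- split off.
  multipartite-complement : ∀ {L Ps} → Multipartite L Ps → ∃[ R ] L ↭ R ++ concat Ps
  multipartite-complement p = complement _
    (Unique.concat⁺ (unique p) (AllPairs.map
      (λ j {v} (v∈P , v∈P′) → irrefl _ (All.lookup (All.lookup j v∈P) v∈P′)) (cross p)))
    (All.concat⁺ (inside p))

  contains-⊆ : ∀ {k m L L′} → (∀ {v} → v ∈ L → v ∈ L′) → Contains k m L → Contains k m L′
  contains-⊆ L⊆ (Ps , s , family c u i) = Ps , s , family c u (All.map (All.map L⊆) i)

map-≡⇒All : ∀ {X Y : Set} {f g : X → Y} xs → map f xs ≡ map g xs → All (λ x → f x ≡ g x) xs
map-≡⇒All []       _  = []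
map-≡⇒All (x ∷ xs) eq = ∷-injectiveˡ eq ∷ map-≡⇒All xs (∷-injectiveʳ eq)

few? : ∀ M → Decidable (Few M)
few? M bs = length (filter T? bs) ℕ.≤? M

-- Vertices with the same type that have many neighbours in each part form an additional part
-- together with these neighbours.
enlarge : ∀ {N} (G : Graph N) {L Ps R k m} M → Multipartite G L Ps → L ↭ R ++ concat Ps → Unique L →
          length Ps ≡ k → All (λ P → length P ≡ m) Ps →
          M * 2 ^ (m * k) < length (filter (¬? ∘ any? (few? M)) (map (type G Ps) R)) →
          Contains G (suc k) M L
enlarge {N} G {L} {Ps} {R} {k} {m} M mp L↭ L! #Ps sizes many = build witness
  where
  bad? = λ v → ¬? (any? (few? M) (type G Ps v))
  bads = filter bad? R

  witness : ∃[ t ] ∃[ W ] M < length W × Unique W × All (λ w → type G Ps w ≡ t) W × All (_∈ bads) W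
  witness = fibre (≡-dec (≡-dec _≟ᵇ_)) (type G Ps) M (lists (rowsOf m) k) bads
    (Unique.filter⁺ bad? (Unique-++⁻ˡ R (Unique-↭ L↭ L!)))
    (All.universal (type∈lists G sizes #Ps) bads)
    (subst₂ (λ a b → M * a < b) (sym (length-lists-rowsOf m k))
      (length-filter-map (¬? ∘ any? (few? M)) (type G Ps) R) many)

  build : (∃[ t ] ∃[ W ] M < length W × Unique W × All (λ w → type G Ps w ≡ t) W × All (_∈ bads) W) →
          Contains G (suc k) M L
  build (t , W@(w₀ ∷ _) , M< , W! , types , W⊆@(w₀∈ ∷ _)) =
    take M W ∷ map shrink Ps ,
    (cong suc (trans (length-map shrink Ps) #Ps) ,
      length-take≡ M W (ℕ.<⇒≤ M<) ∷ All.map⁺ (All.map (λ {P} → shrink-size P) large)) ,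
    family
      (All.map⁺ (All.tabulate join-W) ∷
        AllPairs.map⁺ (AllPairs.map
          (λ j → All.take⁺ M (All.filter⁺ nbr? (All.map (All.take⁺ M ∘ All.filter⁺ nbr?) j))) (cross mp)))
      (Unique.take⁺ M W! ∷ All.map⁺ (All.map (Unique.take⁺ M ∘ Unique.filter⁺ nbr?) (unique mp)))
      (All.take⁺ M (All.map bads⊆L W⊆) ∷ All.map⁺ (All.map (All.take⁺ M ∘ All.filter⁺ nbr?) (inside mp)))
    where
    -- All of `W` has the type of `w₀`, so the neighbours of `w₀` in the parts are joined to every
    -- vertex of `W`; as `w₀` is bad, each part has more than `M` of them.
    nbr? = λ p → T? (adj G w₀ p)
    shrink = λ P → take M (filter nbr? P)

    bads⊆L : ∀ {v} → v ∈ bads → v ∈ L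
    bads⊆L v∈ = ∈-resp-↭ (↭-sym L↭) (∈-++⁺ˡ {xs = R} (All.lookup (All.filter⁺ bad? (All.tabulate {xs = R} id)) v∈))

    large : All (λ P → M < length (filter nbr? P)) Ps
    large = All.map (λ {P} ¬few → subst (M <_) (length-filter-map T? (adj G w₀) P) (ℕ.≰⇒> ¬few))
      (All.map⁻ (All.¬Any⇒All¬ _ (All.lookup (All.all-filter bad? R) w₀∈)))

    shrink-size : ∀ P → M < length (filter nbr? P) → length (shrink P) ≡ M
    shrink-size P M< = length-take≡ M (filter nbr? P) (ℕ.<⇒≤ M<)

    join-W : ∀ {P} → P ∈ Ps → Cross (Adjacent G) (take M W) (shrink P)
    join-W {P} P∈ = All.take⁺ M (All.map (λ {w} eq →
      let same = All.lookup (map-≡⇒All Ps (trans eq (sym (All.lookup types (here refl))))) P∈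
      in All.take⁺ M (All.zipWith (λ (eq , e) → subst T (sym eq) e)
           (All.filter⁺ nbr? (map-≡⇒All P same) , All.all-filter nbr? P))) types)

-- The row from `good` costs `e` bits and the `k` others `m` bits each. The position of that row,
-- one of at most three, and the added one fit into two bits.
length-someIn-rowsOf : ∀ good m k e → suc (suc k) ≤ 4 → length good ≤ 2 ^ e →
                       suc (length (someIn good (rowsOf m) (suc k))) ≤ 2 ^ (2 + (e + m * k))
length-someIn-rowsOf good m k e k≤ good≤ = begin
  suc (length (someIn good (rowsOf m) (suc k)))
    ≤⟨ ℕ.+-mono-≤ (ℕ.m^n>0 2 (e + m * k))
         (ℕ.≤-trans (length-someIn good (rowsOf m) k) (ℕ.*-monoʳ-≤ (suc k) types≤)) ⟩
  suc (suc k) * 2 ^ (e + m * k)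
    ≤⟨ ℕ.*-monoˡ-≤ (2 ^ (e + m * k)) k≤ ⟩
  2 ^ 2 * 2 ^ (e + m * k)
    ≡⟨ ℕ.^-distribˡ-+-* 2 2 (e + m * k) ⟨
  2 ^ (2 + (e + m * k)) ∎
  where
  open ℕ.≤-Reasoning
  types≤ : length good * length (rowsOf m) ^ k ≤ 2 ^ (e + m * k)
  types≤ = begin
    length good * length (rowsOf m) ^ k  ≤⟨ ℕ.*-mono-≤ good≤ (ℕ.≤-reflexive
                                              (trans (cong (_^ k) (length-rowsOf m)) (ℕ.^-*-assoc 2 m k))) ⟩
    2 ^ e * 2 ^ (m * k)                  ≡⟨ ℕ.^-distribˡ-+-* 2 e (m * k) ⟨
    2 ^ (e + m * k)                      ∎

-- Graphs without large complete multipartite subgraphs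

Avoids : (k m : ℕ) → GraphClass
Avoids k m G L = ¬ Contains G k m L

¬contains-1 : ∀ {N} (G : Graph N) M {L} → Unique L → ¬ Contains G 1 M L → length L < M
¬contains-1 G M {L} L! ¬c = ℕ.≰⇒> λ M≤ → ¬c
  (take M L ∷ [] , (refl , length-take≡ M L M≤ ∷ []) ,
   family ([] ∷ []) (Unique.take⁺ M L! ∷ []) (All.take⁺ M (All.tabulate id) ∷ []))

-- Only graphs with fewer than `M` vertices are left, and for them `n * n` is at most `M * n`; for
-- larger `n` the empty code serves.
bounded-avoids-1 : ∀ D A M → Bounded D A (Avoids 1 M)
bounded-avoids-1 D A M = M * D , 0 , λ n → xs n (n ℕ.<? M)
  where
  xs : ∀ n → Dec (n < M) →
       ∃[ xs ] length xs ^ D ≤ 2 ^ (A * (n * n) + M * D * n + 0) × CodedBy (Avoids 1 M) n xs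
  xs n (yes n<M) = triangles n ,
    ℕ.≤-trans (power-bound D (n * n) (length-triangles n)) (ℕ.^-monoʳ-≤ 2 (begin
      n * n * D                         ≤⟨ ℕ.*-monoˡ-≤ D (ℕ.*-monoˡ-≤ n (ℕ.<⇒≤ n<M)) ⟩
      M * n * D                         ≡⟨ eq M n D ⟩
      M * D * n                         ≤⟨ ℕ.m≤n+m (M * D * n) (A * (n * n)) ⟩
      A * (n * n) + M * D * n           ≡⟨ ℕ.+-identityʳ _ ⟨
      A * (n * n) + M * D * n + 0       ∎)) ,
    λ { G L _ refl _ → L , ↭-refl , ∈-triangles G L }
    where
    open ℕ.≤-Reasoning
    eq : ∀ M n D → M * n * D ≡ M * D * n
    eq = solve-∀
  xs n (no n≮M) = [] ,
    ℕ.≤-trans (ℕ.^-monoˡ-≤ D (z≤n {1}))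
      (ℕ.≤-trans (ℕ.≤-reflexive (ℕ.^-zeroˡ D)) (ℕ.m^n>0 2 (A * (n * n) + M * D * n + 0))) ,
    λ { G L L! refl ¬c → contradiction (¬contains-1 G M L! ¬c) n≮M }

-- A subgraph with `k` parts of size `m` is removed if there is one. By `enlarge`, more than
-- `M * 2 ^ (m * k)` vertices with over `M` neighbours in every part would yield `suc k` parts of
-- size `M`.
bounded-avoids-suc : ∀ {D A} k M m .{{_ : NonZero (k * m)}} τ →
  suc (length (someIn (fewTrue M m) (rowsOf m) k)) ^ D ≤ 2 ^ τ → τ ≤ 2 * A * (k * m) →
  Bounded D A (Avoids k m) → Bounded D A (Avoids (suc k) M)
bounded-avoids-suc {D} {A} k M m τ types≤ τ≤ =
  Stage.stage D A k m (M * 2 ^ (m * k)) τ (few? M) (fewTrue M m) (λ { bs refl → ∈-fewTrue M bs }) types≤ τ≤ split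
  where
  split : ∀ {N} (G : Graph N) L → Unique L → Avoids (suc k) M G L →
          Avoids k m G L ⊎ Split k m (M * 2 ^ (m * k)) (few? M) (Avoids (suc k) M) G L
  split G L L! avoids with contains? G k m L
  ... | no  ¬c = inj₁ ¬c
  ... | yes (Ps , (#Ps , sizes) , mp) with R , L↭ ← multipartite-complement G mp = inj₂ record
    { parts   = Ps
    ; rest    = R
    ; split   = L↭
    ; #parts  = #Ps
    ; sizes   = sizes
    ; inClass = λ c → avoids (contains-⊆ G (λ v∈ → ∈-resp-↭ (↭-sym L↭) (∈-++⁺ˡ v∈)) c)
    ; mostQ   = ℕ.≮⇒≥ λ many → avoids (enlarge G M mp L↭ L! #Ps sizes many)
    }

module _ (p q : ℕ) where

  private
    -- With ε = `p / q`, the ratio of `A` to `D` is 1/3 + 2ε/3; the remaining ε/3 is left for the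
    -- linear terms.
    D A : ℕ
    D = 3 * q
    A = q + 2 * p

  exponent≤ : ∀ {e s} → 3 * e ≤ 2 * s → e * D ≤ 2 * A * s
  exponent≤ {e} {s} 3e≤2s = begin
    e * (3 * q)                ≡⟨ eq₁ e q ⟩
    3 * e * q                  ≤⟨ ℕ.*-monoˡ-≤ q 3e≤2s ⟩
    2 * s * q                  ≤⟨ ℕ.m≤m+n _ (4 * p * s) ⟩
    2 * s * q + 4 * p * s      ≡⟨ eq₂ p q s ⟩
    2 * (q + 2 * p) * s        ∎
    where
    open ℕ.≤-Reasoning
    eq₁ : ∀ e q → e * (3 * q) ≡ 3 * e * q
    eq₁ = solve-∀
    eq₂ : ∀ p q s → 2 * s * q + 4 * p * s ≡ 2 * (q + 2 * p) * s
    eq₂ = solve-∀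

  -- With m = 5 j, a part with at most M neighbours costs 3 M + j bits instead of m; j is chosen so
  -- that k - 1 other parts, k ≤ 2, still leave at most 2/3 of k m bits.
  parts-size : ℕ → ℕ
  parts-size M = 5 * (3 + 5 * M)

  bounded-next : ∀ k M → let m = parts-size M in
    suc (suc k) ≤ 4 → 3 * (2 + (3 * M + (3 + 5 * M) + m * k)) ≤ 2 * (suc k * m) →
    Bounded D A (Avoids (suc k) m) → Bounded D A (Avoids (suc (suc k)) M)
  bounded-next k M k≤ 3e≤2s = bounded-avoids-suc {D} {A} (suc k) M m (e * D)
    (power-bound D e (length-someIn-rowsOf (fewTrue M m) m k (3 * M + j) k≤ (length-fewTrue M j)))
    (exponent≤ {e} {suc k * m} 3e≤2s)
    where
    j = 3 + 5 * M
    m = parts-size M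
    e = 2 + (3 * M + j + m * k)

  bounded-avoids-2 : ∀ M → Bounded D A (Avoids 2 M)
  bounded-avoids-2 M = bounded-next 0 M (ℕ.≤ᵇ⇒≤ 2 4 _)
    (ℕ.≤-trans (ℕ.m≤m+n _ (26 * M + 15)) (ℕ.≤-reflexive (eq M))) (bounded-avoids-1 D A (parts-size M))
    where
    eq : ∀ M → 3 * (2 + (3 * M + (3 + 5 * M) + 5 * (3 + 5 * M) * 0)) + (26 * M + 15)
             ≡ 2 * (1 * (5 * (3 + 5 * M)))
    eq = solve-∀

  bounded-avoids-3 : ∀ M → Bounded D A (Avoids 3 M)
  -- For `k = 1` the inequality amounts to 6 + 9 M ≤ 2 j, and j = 3 + 5 M leaves a surplus of M.
  bounded-avoids-3 M = bounded-next 1 M (ℕ.≤ᵇ⇒≤ 3 4 _)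
    (ℕ.≤-trans (ℕ.m≤m+n _ M) (ℕ.≤-reflexive (eq M))) (bounded-avoids-2 (parts-size M))
    where
    eq : ∀ M → 3 * (2 + (3 * M + (3 + 5 * M) + 5 * (3 + 5 * M) * 1)) + M ≡ 2 * (2 * (5 * (3 + 5 * M)))
    eq = solve-∀

-- Parts separated by a position function

module Separation {X : Set} (r : X → ℕ) where

  below above : ℕ → List X → List X
  below t = filter λ x → r x ℕ.<? t
  above t = filter λ x → ¬? (r x ℕ.<? t)

  -- The least threshold below which some part has m elements; the others have lost fewer than m.
  firstReach : ∀ m .{{_ : NonZero m}} t Ps → Any (λ P → m ≤ length (below t P)) Ps →
               ∃[ t ] Any (λ P → m ≤ length (below (suc t) P)) Ps × All (λ P → length (below t P) < m) Ps
  firstReach m zero Ps reach with P , m≤ ← satisfied reach =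
    contradiction (subst (λ l → m ≤ length l) (filter-none (λ x → r x ℕ.<? 0) (All.universal (λ _ ()) P)) m≤)
      (ℕ.<⇒≱ (>-nonZero⁻¹ m))
  firstReach m (suc t) Ps reach with any? (λ P → m ℕ.≤? length (below t P)) Ps
  ... | yes reach′ = firstReach m t Ps reach′
  ... | no  ¬reach = t , reach , All.map ℕ.≰⇒> (All.¬Any⇒All¬ Ps ¬reach)

  bring : ∀ {P : Pred (List X) 0ℓ} {Ps} → Any P Ps → ∃[ A ] ∃[ Bs ] Ps ↭ A ∷ Bs × P A
  bring {Ps = A ∷ Bs} (here p)  = A , Bs , ↭-refl , p
  bring {Ps = B ∷ Ps} (there q) =
    let A , Bs , Ps↭ , p = bring q
    in A , B ∷ Bs , ↭-trans (↭-prep B Ps↭) (↭-swap B A ↭-refl) , p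

  upperBound : ∀ P → ∃[ t ] All (λ x → r x < t) P
  upperBound []      = 0 , []
  upperBound (x ∷ P) = let t , P<t = upperBound P in
    suc (r x) ⊔ t , ℕ.m≤m⊔n (suc (r x)) t ∷ All.map (λ x<t → ℕ.≤-trans x<t (ℕ.m≤n⊔m (suc (r x)) t)) P<t

  OrderedBy : (X → X → Set) → X → X → Set
  OrderedBy R x y = R x y × r x ≤ r y

  Separated : ℕ → ℕ → (X → X → Set) → Pred X 0ℓ → Set
  Separated m k R E = ∃[ Qs ] length Qs ≡ k × All (λ Q → length Q ≡ m) Qs × Family (OrderedBy R) E Qs

  module _ {R : X → X → Set} (R-sym : ∀ {x y} → R x y → R y x) where

    Family-↭ : ∀ {E Ps Qs} → Ps ↭ Qs → Family R E Ps → Family R E Qs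
    Family-↭ Ps↭ (family c u i) = family
      (↭ₛ.AllPairs-resp-↭ (setoid (List X)) (λ c → All.map (All.map R-sym) (Cross-flip c))
        ((λ { refl c → c }) , (λ { refl c → c })) (↭⇒↭ₛ Ps↭) c)
      (All-resp-↭ Ps↭ u) (All-resp-↭ Ps↭ i)

    -- Greedy choice by increasing position: a part that has `m` elements up to the least possible
    -- threshold `t` provides the first part. Every other part loses fewer than `m` elements below
    -- `t`, so `k * m` elements last for `k` rounds.
    separate : ∀ m .{{_ : NonZero m}} k {E} Ps → length Ps ≡ k → All (λ P → k * m ≤ length P) Ps →
               Family R E Ps → Separated m k R E
    separate m zero    [] _ _ _ = [] , refl , [] , family [] [] []
    separate m (suc k) {E} Ps@(P₀ ∷ _) #Ps sizes fam =
      let t , P₀<t            = upperBound P₀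
          t , reach , few     = firstReach m t Ps (here (subst (λ P → m ≤ length P)
                                  (sym (filter-all (λ x → r x ℕ.<? t) P₀<t))
                                  (ℕ.≤-trans (ℕ.m≤m+n m (k * m)) (All.head sizes))))
          P , Ps′ , Ps↭ , m≤  = bring reach
      in extract t P Ps′ m≤ (ℕ.suc-injective (trans (sym (↭-length Ps↭)) #Ps))
           (All.tail (All-resp-↭ Ps↭ sizes)) (All.tail (All-resp-↭ Ps↭ few)) (Family-↭ Ps↭ fam)
      where
      extract : ∀ t P Ps′ → m ≤ length (below (suc t) P) → length Ps′ ≡ k → All (λ B → suc k * m ≤ length B) Ps′ →
                All (λ B → length (below t B) < m) Ps′ → Family R E (P ∷ Ps′) → Separated m (suc k) R E
      extract t P Ps′ m≤ #Ps′ sizes few (family (c ∷ cs) (u ∷ us) (i ∷ is)) =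
        let Qs , #Qs , sizesQ , family cQ uQ iQ = separate m k (map (above t) Ps′)
              (trans (length-map (above t) Ps′) #Ps′) (All.map⁺ (All.zipWith (λ {B} → enough {B}) (sizes , few)))
              (family (AllPairs.map⁺ (AllPairs.map (λ c → All.filter⁺ _ (All.map (All.filter⁺ _) c)) cs))
                      (All.map⁺ (All.map (Unique.filter⁺ _) us))
                      (All.map⁺ (All.zipWith (λ {B} → inherit {B}) (is , c))))
        in P′ ∷ Qs , cong suc #Qs , length-take≡ m (below (suc t) P) m≤ ∷ sizesQ ,
           family (All.map before iQ ∷ cQ)
                  (Unique.take⁺ m (Unique.filter⁺ _ u) ∷ uQ)
                  (All.take⁺ m (All.filter⁺ _ i) ∷ All.map (All.map proj₁) iQ)
        where
        P′ = take m (below (suc t) P)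

        P′≤t : All (λ p → r p ≤ t) P′
        P′≤t = All.take⁺ m (All.map s≤s⁻¹ (All.all-filter (λ x → r x ℕ.<? suc t) P))

        enough : ∀ {B} → suc k * m ≤ length B × length (below t B) < m → k * m ≤ length (above t B)
        enough {B} (large , few) = ℕ.+-cancelˡ-≤ m (k * m) (length (above t B)) (begin
          m + k * m                               ≤⟨ large ⟩
          length B                                ≡⟨ length-filter-¬ (λ x → r x ℕ.<? t) B ⟨
          length (below t B) + length (above t B) ≤⟨ ℕ.+-monoˡ-≤ _ (ℕ.<⇒≤ few) ⟩
          m + length (above t B)                  ∎)
          where open ℕ.≤-Reasoning

        -- The recursive call returns parts of which only the element predicate is known, so this
        -- predicate has to record that they come after `P′` and are joined to it.
        After : Pred X 0ℓ
        After x = E x × t ≤ r x × All (λ p → R p x) P′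

        inherit : ∀ {B} → All E B × Cross R P B → All After (above t B)
        inherit {B} (e , c) = All.zipWith (λ (e , ¬< , c) → e , ℕ.≮⇒≥ ¬< , c)
          (All.filter⁺ _ e , All.zip (All.all-filter _ B ,
            All.filter⁺ _ (All.map (All.take⁺ m ∘ All.filter⁺ _) (Cross-flip c))))

        before : ∀ {Q} → All After Q → Cross (OrderedBy R) P′ Q
        before after = Cross-flip (All.map (λ (_ , t≤ , c) →
          All.zipWith (λ (p≤t , p~) → p~ , ℕ.≤-trans p≤t t≤) (P′≤t , c)) after)

-- Neighbourhoods in shortcut-free graphs

Constant : Pred (List Bool) 0ℓ
Constant bs = All T bs ⊎ All (¬_ ∘ T) bs

constant? : Decidable Constant
constant? bs = all? T? bs ⊎-dec all? (¬? ∘ T?) bs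

constants : ℕ → List (List Bool)
constants m = replicate m true ∷ replicate m false ∷ []

∈-constants : ∀ bs → Constant bs → bs ∈ constants (length bs)
∈-constants bs (inj₁ all-true)  = here (true≡ bs all-true)
  where
  true≡ : ∀ bs → All T bs → bs ≡ replicate (length bs) true
  true≡ []          _        = refl
  true≡ (true ∷ bs) (_ ∷ ts) = cong (true ∷_) (true≡ bs ts)
∈-constants bs (inj₂ all-false) = there (here (false≡ bs all-false))
  where
  false≡ : ∀ bs → All (¬_ ∘ T) bs → bs ≡ replicate (length bs) false
  false≡ []           _        = refl
  false≡ (true  ∷ bs) (f ∷ _)  = contradiction _ f
  false≡ (false ∷ bs) (_ ∷ fs) = cong (false ∷_) (false≡ bs fs)

¬constant⇒mixed : ∀ {X : Set} (f : X → Bool) P → ¬ Constant (map f P) →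
                  ∃[ p ] ∃[ p′ ] (p ∈ P × T (f p)) × (p′ ∈ P × ¬ T (f p′))
¬constant⇒mixed f P ¬c =
  let p′ , p′∈ , fp′ = find (Any.map⁻ (All.¬All⇒Any¬ T? (map f P) (¬c ∘ inj₁)))
      p , p∈ , fp    = find (Any.map⁻ (All.¬All⇒Any¬ (¬? ∘ T?) (map f P) (¬c ∘ inj₂)))
  in p , p′ , (p∈ , decidable-stable (T? (f p)) fp) , (p′∈ , fp′)

module _ {N} {G : Graph N} (sf : ShortcutFree G) where

  open ShortcutFree sf
  open Separation position

  adjacent⇒≢ : ∀ {x y} → Adjacent G x y → position x ≢ position y
  adjacent⇒≢ {x} e eq with refl ← position-injective eq = irrefl G x e

  edge< : ∀ {x y} → OrderedBy (Adjacent G) x y → position x < position y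
  edge< (e , x≤y) = ℕ.≤∧≢⇒< x≤y (adjacent⇒≢ e)

  -- A vertex that distinguishes two vertices in each of A, B and C closes a four-cycle with them
  -- which is a shortcut, wherever the vertex lies.
  constant-on-part : ∀ A B C → AllPairs (Cross (OrderedBy (Adjacent G))) (A ∷ B ∷ C ∷ []) →
                     ∀ v → Any Constant (type G (A ∷ B ∷ C ∷ []) v)
  constant-on-part A B C ((AB ∷ AC ∷ []) ∷ (BC ∷ []) ∷ [] ∷ []) v
    with any? constant? (type G (A ∷ B ∷ C ∷ []) v)
  ... | yes c = c
  ... | no ¬c
    with a , a′ , (a∈ , va) , (a′∈ , ¬va′) ← ¬constant⇒mixed (adj G v) A (¬c ∘ here)
       | b , b′ , (b∈ , vb) , (b′∈ , ¬vb′) ← ¬constant⇒mixed (adj G v) B (¬c ∘ there ∘ here)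
       | c , c′ , (c∈ , vc) , (c′∈ , ¬vc′) ← ¬constant⇒mixed (adj G v) C (¬c ∘ there ∘ there ∘ here)
    = ⊥-elim shortcut
    where
    ab′ = All.lookup (All.lookup AB a∈) b′∈
    b′c = All.lookup (All.lookup BC b′∈) c∈
    ac  = All.lookup (All.lookup AC a∈) c∈
    ac′ = All.lookup (All.lookup AC a∈) c′∈
    bc′ = All.lookup (All.lookup BC b∈) c′∈
    a′b = All.lookup (All.lookup AB a′∈) b∈
    a′c = All.lookup (All.lookup AC a′∈) c∈
    flip = adjacent-sym G
    shortcut : ⊥
    shortcut with ℕ.<-cmp (position v) (position a)
                | ℕ.<-cmp (position v) (position c)
                | ℕ.<-cmp (position v) (position b)
    -- In order of position the four cycles are `v a b′ c`, `a b′ c v`, `a v b c′` and `a′ b v c`.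
    -- Each lacks the diagonal from `v` to a primed vertex.
    ... | tri< v<a _ _ | _ | _ = ¬vb′ (proj₁ (no-shortcut v<a (edge< ab′) (edge< b′c) va (proj₁ ab′) (proj₁ b′c) vc))
    ... | tri≈ _ eq _  | _ | _ = adjacent⇒≢ va eq
    ... | _ | tri≈ _ eq _  | _ = adjacent⇒≢ vc eq
    ... | _ | _ | tri≈ _ eq _  = adjacent⇒≢ vb eq
    ... | tri> _ _ a<v | tri> _ _ c<v | _ =
      ¬vb′ (flip (proj₂ (no-shortcut (edge< ab′) (edge< b′c) c<v (proj₁ ab′) (proj₁ b′c) (flip vc) (flip va))))
    ... | tri> _ _ a<v | tri< v<c _ _ | tri< v<b _ _ =
      ¬vc′ (proj₂ (no-shortcut a<v v<b (edge< bc′) (flip va) vb (proj₁ bc′) (proj₁ ac′)))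
    ... | tri> _ _ a<v | tri< v<c _ _ | tri> _ _ b<v =
      ¬va′ (flip (proj₁ (no-shortcut (edge< a′b) b<v v<c (proj₁ a′b) (flip vb) vc (proj₁ a′c))))

-- Parts of size `3 * q` contain parts of size `q` separated by position, and then no vertex is
-- exceptional. A type takes `3 + q * 2` bits; the 3 fits into the slack `4 * p` of the rate.
bounded-shortcutFree : ∀ p q .{{_ : NonZero p}} .{{_ : NonZero q}} →
                       Bounded (3 * q) (q + 2 * p) (λ G _ → ShortcutFree G)
bounded-shortcutFree p q =
  Stage.stage (3 * q) (q + 2 * p) 3 q 0 (e * (3 * q)) {{ℕ.m*n≢0 3 q}}
    constant? (constants q) (λ { bs refl → ∈-constants bs })
    (power-bound (3 * q) e (length-someIn-rowsOf (constants q) q 2 1 ℕ.≤-refl ℕ.≤-refl))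
    exponent split (bounded-avoids-3 p q (3 * q))
  where
  e = 2 + (1 + q * 2)
  exponent : e * (3 * q) ≤ 2 * (q + 2 * p) * (3 * q)
  exponent = ℕ.*-monoˡ-≤ (3 * q) (begin
    3 + q * 2              ≤⟨ ℕ.+-monoˡ-≤ (q * 2) (ℕ.≤-trans (ℕ.≤ᵇ⇒≤ 3 4 _) (ℕ.*-monoʳ-≤ 4 (>-nonZero⁻¹ p))) ⟩
    4 * p + q * 2          ≡⟨ eq p q ⟩
    2 * (q + 2 * p)        ∎)
    where
    open ℕ.≤-Reasoning
    eq : ∀ p q → 4 * p + q * 2 ≡ 2 * (q + 2 * p)
    eq = solve-∀
  split : ∀ {N} (G : Graph N) L → Unique L → ShortcutFree G →
          Avoids 3 (3 * q) G L ⊎ Split 3 q 0 constant? (λ G _ → ShortcutFree G) G L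
  split G L L! sf with contains? G 3 (3 * q) L
  ... | no  ¬c = inj₁ ¬c
  ... | yes (Ps , (#Ps , sizes) , mp)
    with A ∷ B ∷ C ∷ [] , refl , sizes′ , family c u i ←
         Separation.separate (ShortcutFree.position sf) (adjacent-sym G) q 3 Ps #Ps
           (All.map (ℕ.≤-reflexive ∘ sym) sizes) mp
    with R , L↭ ← multipartite-complement G (family (AllPairs.map (All.map (All.map proj₁)) c) u i) = inj₂ record
    { parts   = A ∷ B ∷ C ∷ []
    ; rest    = R
    ; split   = L↭
    ; #parts  = refl
    ; sizes   = sizes′
    ; inClass = sf
    ; mostQ   = ℕ.≤-reflexive (cong length (filter-none (¬? ∘ any? constant?)
                  (All.map⁺ (All.universal (λ v ¬const → ¬const (constant-on-part sf A B C c v)) R))))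
    }

-- 3-colourable graphs are word-representable

Colour : Set
Colour = Fin 3

-- 1F and 2F mark the two letters of the non-edge at hand.
Role : Set
Role = Fin 3

-- A block of the word, as a set of letters given by colour and role alone; this makes the gadgets
-- verifiable by evaluation.
Level : Set
Level = Colour → Role → Bool

only : Colour → Level
only c d ρ = does (d ≟ c)

role : Role → Level
role σ d ρ = does (ρ ≟ σ)

_∖_ : Level → Level → Level
(S ∖ S′) d ρ = S d ρ ∧ not (S′ d ρ)

x-early : List Level
x-early = concatMap (λ c → (λ d ρ → only c d ρ ∧ role 1F d ρ) ∷ (only c ∖ role 1F) ∷ []) (allFin 3)

-- `y`, then `x`, follow the other letters of the colour `i` of `x`. If `y` has the next colour, it
-- moves ahead of its own class but stays after all its neighbours of smaller colour, as `x` is not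
-- one of them.
yx-late : Colour → List Level
yx-late i =
  concatMap (λ c → (only c ∖ (λ d ρ → role 1F d ρ ∨ role 2F d ρ)) ∷ swapped (does (c ≟ i))) (allFin 3)
  where
  swapped : Bool → List Level
  swapped true  = role 2F ∷ role 1F ∷ []
  swapped false = []

-- For a non-edge x, y whose colours i ≤ j are equal or consecutive, two linear extensions of the
-- orientation by colours, of which only the first has x before y.  For i = 0 and j = 2 there may be
-- a directed path from x to y; then x is read twice before y is read at all.
separating : Colour → Colour → List Level
separating 0F 2F = only 0F ∷ only 1F ∷ (only 2F ∖ role 2F) ∷ role 1F ∷
                   role 2F ∷ (only 0F ∖ role 1F) ∷ only 1F ∷ only 2F ∷ []
separating i  _  = x-early ++ yx-late i

plain : List Level
plain = map only (allFin 3)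

-- The state of an edge after complete passes: colours are read in increasing order from the right,
-- so the letter of larger colour is leftmost.
home : Colour → Colour → Fin 4
home c d with does (c Fin.<? d)
... | true  = 2F
... | false = 1F

home≢3 : ∀ c d → home c d ≢ 3F
home≢3 c d with does (c Fin.<? d)
... | true  = λ ()
... | false = λ ()

Legal : Colour → Colour → Colour → Role → Set
Legal i j c ρ = (ρ ≡ 1F → c ≡ i) × (ρ ≡ 2F → c ≡ j)

legal? : ∀ i j c ρ → Dec (Legal i j c ρ)
legal? i j c ρ = ((ρ ≟ 1F) →-dec (c ≟ i)) ×-dec ((ρ ≟ 2F) →-dec (c ≟ j))

module _ {n : ℕ} where

  -- The order of x and y within a level is not tracked.
  touch : Bool → Bool → Fin 4 → Maybe (Fin 4)
  touch true  true  s = nothing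
  touch true  false s = just (readˣ {n} s)
  touch false true  s = just (readʸ {n} s)
  touch false false s = just s

  run : List Level → Colour → Role → Colour → Role → Fin 4 → Maybe (Fin 4)
  run []       c ρ d σ s = just s
  run (S ∷ Ss) c ρ d σ s = touch (S c ρ) (S d σ) s >>= run Ss c ρ d σ

  private
    _≟ᵐ_ = Maybe.≡-dec (_≟_ {4})

  plain-home : ∀ c d → c ≢ d → run plain c 0F d 0F 0F ≡ just (home c d)
  plain-home = from-yes (Fin.all? λ c → Fin.all? λ d → ¬? (c ≟ d) →-dec
    (run plain c 0F d 0F 0F ≟ᵐ just (home c d)))

  -- Edges survive, by evaluation of all cases. The marked letters form a non-edge, so an edge has
  -- an unmarked end.
  separating-home : ∀ i j → i Fin.≤ j → ∀ c d → c ≢ d → ∀ ρ σ → Legal i j c ρ → Legal i j d σ →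
                    ρ ≡ 0F ⊎ σ ≡ 0F → run (separating i j) c ρ d σ (home c d) ≡ just (home c d)
  separating-home = from-yes (Fin.all? λ i → Fin.all? λ j → (i Fin.≤? j) →-dec
    Fin.all? λ c → Fin.all? λ d → ¬? (c ≟ d) →-dec Fin.all? λ ρ → Fin.all? λ σ →
    legal? i j c ρ →-dec (legal? i j d σ →-dec (((ρ ≟ 0F) ⊎-dec (σ ≟ 0F)) →-dec
    (run (separating i j) c ρ d σ (home c d) ≟ᵐ just (home c d)))))

  -- The state `s` is arbitrary, so the gadget works whatever was read before.
  separating-kills : ∀ i j → i Fin.≤ j → ∀ s → run (separating i j) i 1F j 2F s ≡ just 3F
                                         × run (separating i j) j 2F i 1F s ≡ just 3F
  separating-kills = from-yes (Fin.all? λ i → Fin.all? λ j → (i Fin.≤? j) →-dec Fin.all? λ s →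
    (run (separating i j) i 1F j 2F s ≟ᵐ just 3F) ×-dec (run (separating i j) j 2F i 1F s ≟ᵐ just 3F))

  readBlock : (Fin n → Bool) → Word n → Word n
  readBlock S w = filter (T? ∘ S) (allFin n) ++ w

  readLevels : (Fin n → Colour) → (Fin n → Role) → List Level → Word n → Word n
  readLevels χ ρ []       w = w
  readLevels χ ρ (S ∷ Ss) w = readLevels χ ρ Ss (readBlock (λ v → S (χ v) (ρ v)) w)

  module _ {x y : Fin n} (x≢y : x ≢ y) where

    state-skip : ∀ L w → x ∉ L → y ∉ L → state (L ++ w) x y ≡ state w x y
    state-skip []      w _  _  = refl
    state-skip (z ∷ L) w x∉ y∉ with z ≟ x | z ≟ y
    ... | yes refl | _        = contradiction (here refl) x∉
    ... | no  _    | yes refl = contradiction (here refl) y∉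
    ... | no  _    | no  _    = state-skip L w (x∉ ∘ there) (y∉ ∘ there)

    state-readˣ : ∀ L w → Unique L → x ∈ L → y ∉ L → state (L ++ w) x y ≡ readˣ {n} (state w x y)
    state-readˣ (z ∷ L) w (z∉ ∷ L!) x∈ y∉ with z ≟ x | z ≟ y | x∈
    ... | yes refl | _        | _         =
      cong (readˣ {n}) (state-skip L w (λ x∈L → All.lookup z∉ x∈L refl) (y∉ ∘ there))
    ... | no  z≢x  | _        | here refl = contradiction refl z≢x
    ... | no  _    | yes refl | _         = contradiction (here refl) y∉
    ... | no  _    | no  _    | there x∈L = state-readˣ L w L! x∈L (y∉ ∘ there)

    state-readʸ : ∀ L w → Unique L → x ∉ L → y ∈ L → state (L ++ w) x y ≡ readʸ {n} (state w x y)
    state-readʸ (z ∷ L) w (z∉ ∷ L!) x∉ y∈ with z ≟ x | z ≟ y | y∈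
    ... | yes refl | _        | _         = contradiction (here refl) x∉
    ... | no  _    | yes refl | _         =
      cong (readʸ {n}) (state-skip L w (x∉ ∘ there) (λ y∈L → All.lookup z∉ y∈L refl))
    ... | no  _    | no  z≢y  | here refl = contradiction refl z≢y
    ... | no  _    | no  _    | there y∈L = state-readʸ L w L! (x∉ ∘ there) y∈L

    state-block : ∀ S w {s} → touch (S x) (S y) (state w x y) ≡ just s → state (readBlock S w) x y ≡ s
    state-block S w {s} eq = go (S x) (S y) refl refl eq
      where
      L = filter (T? ∘ S) (allFin n)
      L! : Unique L
      L! = Unique.filter⁺ (T? ∘ S) (Unique.allFin⁺ n)
      in-block : ∀ {v} → S v ≡ true → v ∈ L
      in-block {v} Sv = ∈-filter⁺ (T? ∘ S) (∈-allFin v) (subst T (sym Sv) _)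
      off-block : ∀ {v} → S v ≡ false → v ∉ L
      off-block Sv v∈ = subst T Sv (proj₂ (∈-filter⁻ (T? ∘ S) {xs = allFin n} v∈))
      go : ∀ a b → S x ≡ a → S y ≡ b → touch a b (state w x y) ≡ just s → state (L ++ w) x y ≡ s
      go true  false Sx Sy eq = trans (state-readˣ L w L! (in-block Sx) (off-block Sy)) (Maybe.just-injective eq)
      go false true  Sx Sy eq = trans (state-readʸ L w L! (off-block Sx) (in-block Sy)) (Maybe.just-injective eq)
      go false false Sx Sy eq = trans (state-skip L w (off-block Sx) (off-block Sy)) (Maybe.just-injective eq)

    state-levels : ∀ χ ρ Ss w {s} → run Ss (χ x) (ρ x) (χ y) (ρ y) (state w x y) ≡ just s →
                   state (readLevels χ ρ Ss w) x y ≡ s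
    state-levels χ ρ []       w eq = Maybe.just-injective eq
    state-levels χ ρ (S ∷ Ss) w eq with touch (S (χ x) (ρ x)) (S (χ y) (ρ y)) (state w x y) in eq₁
    ... | just s₁ = state-levels χ ρ Ss _ (trans (cong (run Ss (χ x) (ρ x) (χ y) (ρ y))
                      (state-block (λ v → S (χ v) (ρ v)) w eq₁)) eq)

  -- State 3 is absorbing, so a broken non-edge stays broken under later gadgets.
  state-dead : ∀ (L w : Word n) x y → state w x y ≡ 3F → state (L ++ w) x y ≡ 3F
  state-dead []      w x y eq = eq
  state-dead (z ∷ L) w x y eq with z ≟ x | z ≟ y
  ... | yes _ | _     = cong (readˣ {n}) (state-dead L w x y eq)
  ... | no  _ | yes _ = cong (readʸ {n}) (state-dead L w x y eq)
  ... | no  _ | no  _ = state-dead L w x y eq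

  readLevels-++ : ∀ χ ρ Ss w → ∃[ L ] readLevels χ ρ Ss w ≡ L ++ w
  readLevels-++ χ ρ []       w = [] , refl
  readLevels-++ χ ρ (S ∷ Ss) w =
    let L , eq = readLevels-++ χ ρ Ss (readBlock (λ v → S (χ v) (ρ v)) w)
        block  = filter (T? ∘ λ v → S (χ v) (ρ v)) (allFin n)
    in L ++ block , trans eq (sym (++-assoc L block w))

  module _ (G : Graph n) (χ : Fin n → Colour) (proper : ∀ {x y} → Adjacent G x y → χ x ≢ χ y) where

    roles : Fin n → Fin n → Fin n → Role
    roles x y v with v ≟ x | v ≟ y
    ... | yes _ | _     = 1F
    ... | no  _ | yes _ = 2F
    ... | no  _ | no  _ = 0F

    roles-x : ∀ x y → roles x y x ≡ 1F
    roles-x x y with x ≟ x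
    ... | yes _   = refl
    ... | no  x≢x = contradiction refl x≢x

    roles-y : ∀ {x y} → x ≢ y → roles x y y ≡ 2F
    roles-y {x} {y} x≢y with y ≟ x | y ≟ y
    ... | yes y≡x | _       = contradiction (sym y≡x) x≢y
    ... | no  _   | yes _   = refl
    ... | no  _   | no  y≢y = contradiction refl y≢y

    roles-legal : ∀ x y v → Legal (χ x) (χ y) (χ v) (roles x y v)
    roles-legal x y v with v ≟ x | v ≟ y
    ... | yes refl | _        = (λ _ → refl) , λ ()
    ... | no  _    | yes refl = (λ ()) , λ _ → refl
    ... | no  _    | no  _    = (λ ()) , λ ()

    -- Oriented by weakly increasing colour, as `separating-home` and `separating-kills` require.
    NonEdge : Fin n × Fin n → Set
    NonEdge (x , y) = x ≢ y × ¬ Adjacent G x y × χ x Fin.≤ χ y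

    nonEdge? : ∀ p → Dec (NonEdge p)
    nonEdge? (x , y) = ¬? (x ≟ y) ×-dec ¬? (T? (adj G x y)) ×-dec (χ x Fin.≤? χ y)

    roles-edge : ∀ {x y u v} → ¬ Adjacent G x y → Adjacent G u v → roles x y u ≡ 0F ⊎ roles x y v ≡ 0F
    roles-edge {x} {y} {u} {v} ¬xy uv with u ≟ x | u ≟ y | v ≟ x | v ≟ y
    ... | no  _    | no  _    | _        | _        = inj₁ refl
    ... | _        | _        | no  _    | no  _    = inj₂ refl
    ... | yes refl | _        | yes refl | _        = contradiction (subst T (adj-irrefl G u) uv) λ ()
    ... | _        | yes refl | _        | yes refl = contradiction (subst T (adj-irrefl G u) uv) λ ()
    ... | yes refl | _        | _        | yes refl = contradiction uv ¬xy
    ... | _        | yes refl | yes refl | _        = contradiction (subst T (adj-sym G u v) uv) ¬xy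

    gadget : Fin n × Fin n → Word n → Word n
    gadget (x , y) w with nonEdge? (x , y)
    ... | yes _ = readLevels χ (roles x y) (separating (χ x) (χ y)) w
    ... | no  _ = w

    colourWord : Word n
    colourWord = readLevels χ (λ _ → 0F) plain []

    gadgets : List (Fin n × Fin n) → Word n
    gadgets = foldr gadget colourWord

    -- The initial pass through the colours puts every edge into its home state, and each gadget
    -- returns it there.
    gadgets-home : ∀ ps {u v} → Adjacent G u v → u ≢ v → state (gadgets ps) u v ≡ home (χ u) (χ v)
    gadgets-home []             {u} {v} uv u≢v =
      state-levels u≢v χ (λ _ → 0F) plain [] (plain-home (χ u) (χ v) (proper uv))
    gadgets-home ((x , y) ∷ ps) {u} {v} uv u≢v with nonEdge? (x , y)
    ... | no  _ = gadgets-home ps uv u≢v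
    ... | yes (_ , ¬xy , i≤j) = state-levels u≢v χ (roles x y) (separating (χ x) (χ y)) (gadgets ps)
      (trans (cong (run (separating (χ x) (χ y)) (χ u) (roles x y u) (χ v) (roles x y v))
                   (gadgets-home ps uv u≢v))
        (separating-home (χ x) (χ y) i≤j (χ u) (χ v) (proper uv) (roles x y u) (roles x y v)
          (roles-legal x y u) (roles-legal x y v) (roles-edge ¬xy uv)))

    gadgets-++ : ∀ p w → ∃[ L ] gadget p w ≡ L ++ w
    gadgets-++ (x , y) w with nonEdge? (x , y)
    ... | yes _ = readLevels-++ χ (roles x y) (separating (χ x) (χ y)) w
    ... | no  _ = [] , refl

    gadget-kills : ∀ {x y} → NonEdge (x , y) → ∀ w →
                   state (gadget (x , y) w) x y ≡ 3F × state (gadget (x , y) w) y x ≡ 3F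
    gadget-kills {x} {y} ne w with nonEdge? (x , y)
    ... | no ¬ne = contradiction ne ¬ne
    ... | yes (x≢y , _ , i≤j) =
      state-levels x≢y χ (roles x y) Ss w (subst₂ (λ ρ σ → run Ss (χ x) ρ (χ y) σ (state w x y) ≡ just 3F)
        (sym (roles-x x y)) (sym (roles-y x≢y)) (proj₁ (separating-kills (χ x) (χ y) i≤j (state w x y)))) ,
      state-levels (x≢y ∘ sym) χ (roles x y) Ss w (subst₂ (λ ρ σ → run Ss (χ y) σ (χ x) ρ (state w y x) ≡ just 3F)
        (sym (roles-x x y)) (sym (roles-y x≢y)) (proj₂ (separating-kills (χ x) (χ y) i≤j (state w y x))))
      where Ss = separating (χ x) (χ y)

    gadgets-kill : ∀ {x y} → NonEdge (x , y) → ∀ ps → (x , y) ∈ ps →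
                   state (gadgets ps) x y ≡ 3F × state (gadgets ps) y x ≡ 3F
    gadgets-kill ne (p ∷ ps) (here refl) = gadget-kills ne (gadgets ps)
    gadgets-kill {x} {y} ne (p ∷ ps) (there p∈) with L , eq ← gadgets-++ p (gadgets ps) =
      let dead₁ , dead₂ = gadgets-kill ne ps p∈
      in trans (cong (λ w → state w x y) eq) (state-dead L (gadgets ps) x y dead₁) ,
         trans (cong (λ w → state w y x) eq) (state-dead L (gadgets ps) y x dead₂)

    colourWord-occurs : ∀ Ss {v} w → Any (λ S → T (S (χ v) 0F)) Ss → v ∈ readLevels χ (λ _ → 0F) Ss w
    colourWord-occurs (S ∷ Ss) {v} w (here Sv)
      with L , eq ← readLevels-++ χ (λ _ → 0F) Ss (readBlock (λ v → S (χ v) 0F) w) =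
      subst (v ∈_) (sym eq) (∈-++⁺ʳ L (∈-++⁺ˡ (∈-filter⁺ (T? ∘ λ v → S (χ v) 0F) (∈-allFin v) Sv)))
    colourWord-occurs (S ∷ Ss) w (there Sv) = colourWord-occurs Ss _ Sv

    plain-covers : ∀ c → Any (λ S → T (S c 0F)) plain
    plain-covers 0F = here _
    plain-covers 1F = there (here _)
    plain-covers 2F = there (there (here _))

    gadgets-occurs : ∀ ps v → v ∈ gadgets ps
    gadgets-occurs []       v = colourWord-occurs plain [] (plain-covers (χ v))
    gadgets-occurs (p ∷ ps) v with L , eq ← gadgets-++ p (gadgets ps) =
      subst (v ∈_) (sym eq) (∈-++⁺ʳ L (gadgets-occurs ps v))

    -- Every non-edge is broken by its own gadget, taken in the order of the colours, while every
    -- edge ends in its home state, which is not 3.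
    3-colourable⇒wordRepresentable : WordRepresentable G
    3-colourable⇒wordRepresentable = gadgets pairs , gadgets-occurs pairs , λ x y x≢y → mk⇔
      (λ alt → decidable-stable (T? (adj G x y)) λ ¬xy →
        Equivalence.to (alternate⇔state x≢y (gadgets pairs)) alt (dead x≢y ¬xy (Fin.≤-total (χ x) (χ y))))
      (λ xy → Equivalence.from (alternate⇔state x≢y (gadgets pairs)) λ s≡3 →
        home≢3 (χ x) (χ y) (trans (sym (gadgets-home pairs xy x≢y)) s≡3))
      where
      pairs = cartesianProduct (allFin n) (allFin n)
      ∈-pairs : ∀ x y → (x , y) ∈ pairs
      ∈-pairs x y = ∈-cartesianProduct⁺ (∈-allFin x) (∈-allFin y)
      dead : ∀ {x y} → x ≢ y → ¬ Adjacent G x y → χ x Fin.≤ χ y ⊎ χ y Fin.≤ χ x → state (gadgets pairs) x y ≡ 3F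
      dead {x} {y} x≢y ¬xy (inj₁ x≤y) = proj₁ (gadgets-kill (x≢y , ¬xy , x≤y) pairs (∈-pairs x y))
      dead {x} {y} x≢y ¬xy (inj₂ y≤x) =
        proj₂ (gadgets-kill (x≢y ∘ sym , ¬xy ∘ subst T (adj-sym G y x) , y≤x) pairs (∈-pairs y x))

-- Counting isomorphism classes

lookup-injective : ∀ {X : Set} {xs : List X} → Unique xs → ∀ i j → lookup xs i ≡ lookup xs j → i ≡ j
lookup-injective (_ ∷ _)   zero    zero    _  = refl
lookup-injective (x∉ ∷ _)  zero    (suc j) eq = contradiction eq (All.lookup x∉ (∈-lookup _))
lookup-injective (x∉ ∷ _)  (suc i) zero    eq = contradiction (sym eq) (All.lookup x∉ (∈-lookup _))
lookup-injective (_ ∷ xs!) (suc i) (suc j) eq = cong suc (lookup-injective xs! i j eq)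

length-rows : ∀ {N} (G : Graph N) L → length (rows G L) ≡ length L
length-rows G []      = refl
length-rows G (x ∷ L) = cong suc (length-rows G L)

lookup-map≡ : ∀ {X Y Z : Set} {f : X → Z} {g : Y → Z} xs ys → map f xs ≡ map g ys →
              .(len : length xs ≡ length ys) → ∀ i → f (lookup xs i) ≡ g (lookup ys (cast len i))
lookup-map≡ (x ∷ xs) (y ∷ ys) eq len zero    = ∷-injectiveˡ eq
lookup-map≡ (x ∷ xs) (y ∷ ys) eq len (suc i) = lookup-map≡ xs ys (∷-injectiveʳ eq) (ℕ.suc-injective len) i

lookup-rows≡ : ∀ {N} (G H : Graph N) L M → rows G L ≡ rows H M → .(len : length L ≡ length M) → ∀ i j →
               adj G (lookup L i) (lookup L j) ≡ adj H (lookup M (cast len i)) (lookup M (cast len j))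
lookup-rows≡ G H (x ∷ L) (y ∷ M) eq len zero    zero    = trans (adj-irrefl G x) (sym (adj-irrefl H y))
lookup-rows≡ G H (x ∷ L) (y ∷ M) eq len zero    (suc j) = lookup-map≡ L M (∷-injectiveˡ eq) (ℕ.suc-injective len) j
lookup-rows≡ G H (x ∷ L) (y ∷ M) eq len (suc i) zero    =
  trans (adj-sym G _ x) (trans (lookup-map≡ L M (∷-injectiveˡ eq) (ℕ.suc-injective len) i) (adj-sym H y _))
lookup-rows≡ G H (x ∷ L) (y ∷ M) eq len (suc i) (suc j) =
  lookup-rows≡ G H L M (∷-injectiveʳ eq) (ℕ.suc-injective len) i j

private
  transport : ∀ {n} (L M : List (Fin n)) → (∀ v → v ∈ L) → .(length L ≡ length M) → Fin n → Fin n
  transport L M cover len v = lookup M (cast len (index (cover v)))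

  transport-inverse : ∀ {n} (L M : List (Fin n)) (∈L : ∀ v → v ∈ L) (∈M : ∀ v → v ∈ M) → Unique M →
    .(len : length L ≡ length M) .(len′ : length M ≡ length L) →
    ∀ v → transport M L ∈M len′ (transport L M ∈L len v) ≡ v
  transport-inverse L M ∈L ∈M M! len len′ v = begin
    lookup L (cast len′ (index (∈M w)))
      ≡⟨ cong (lookup L ∘ cast len′) (lookup-injective M! _ _ (sym (Any.lookup-index (∈M w)))) ⟩
    lookup L (cast len′ (cast len (index (∈L v))))
      ≡⟨ cong (lookup L) (cast-involutive len′ len (index (∈L v))) ⟩
    lookup L (index (∈L v))
      ≡⟨ Any.lookup-index (∈L v) ⟨
    v ∎
    where
    open ≡-Reasoning
    w = transport L M ∈L len v

-- The isomorphism sends the vertex at each index of `L` to the vertex at the same index of `M`.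
rows-determine : ∀ {n} (G H : Graph n) {L M} → L ↭ allFin n → M ↭ allFin n → rows G L ≡ rows H M → G ≅ H
rows-determine {n} G H {L} {M} L↭ M↭ eq =
  permutation (transport L M ∈L len) (transport M L ∈M (sym len))
    (transport-inverse M L ∈M ∈L (enum! L↭) (sym len) len)
    (transport-inverse L M ∈L ∈M (enum! M↭) len (sym len)) ,
  λ x y → trans (sym (lookup-rows≡ G H L M eq len (index (∈L x)) (index (∈L y))))
    (cong₂ (adj G) (sym (Any.lookup-index (∈L x))) (sym (Any.lookup-index (∈L y))))
  where
  ∈L : ∀ v → v ∈ L
  ∈L v = ∈-resp-↭ (↭-sym L↭) (∈-allFin v)
  ∈M : ∀ v → v ∈ M
  ∈M v = ∈-resp-↭ (↭-sym M↭) (∈-allFin v)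
  enum! : ∀ {K} → K ↭ allFin n → Unique K
  enum! K↭ = Unique-↭ (↭-sym K↭) (Unique.allFin⁺ n)
  len : length L ≡ length M
  len = trans (sym (length-rows G L)) (trans (cong length eq) (length-rows H M))

-- Each class is sent to the index of a code of its representative; by `rows-determine` equal codes
-- mean isomorphic graphs.
classes≤ : ∀ {n a xs} → HasCardinality (WordRepresentableGraphs n) a →
           CodedBy (λ G _ → ShortcutFree G) n xs → a ≤ length xs
classes≤ {n} {a} {xs} card coded = injective⇒≤ {f = place} λ {i} {j} → place-injective i j
  where
  open Bijection card using (to; injective)
  entry : ∀ i → ∃[ L ] L ↭ allFin n × rows (proj₁ (to i)) L ∈ xs
  entry i = coded (proj₁ (to i)) (allFin n) (Unique.allFin⁺ n) (length-tabulate id)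
    (wordRepresentable⇒shortcutFree {G = proj₁ (to i)} (proj₂ (to i)))
  place : Fin a → Fin (length xs)
  place i = index (proj₂ (proj₂ (entry i)))
  place-injective : ∀ i j → place i ≡ place j → i ≡ j
  place-injective i j eq with L , L↭ , r ← entry i | M , M↭ , s ← entry j =
    injective (rows-determine (proj₁ (to i)) (proj₁ (to j)) L↭ M↭
      (trans (Any.lookup-index r) (trans (cong (lookup xs) eq) (sym (Any.lookup-index s)))))

-- Labelled tripartite graphs

funToFin-cong : ∀ {m n} {f g : Fin m → Fin n} → (∀ i → f i ≡ g i) → funToFin f ≡ funToFin g
funToFin-cong {zero}      eq = refl
funToFin-cong {suc m} {n} eq = cong₂ combine (eq zero) (funToFin-cong {m} {n} (λ i → eq (suc i)))

finToFun-injective : ∀ m n {c d : Fin (n ^ m)} → (∀ i → finToFun {n} {m} c i ≡ finToFun {n} {m} d i) → c ≡ d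
finToFun-injective m n {c} {d} eq =
  trans (sym (funToFin-finToFin {m} {n} c))
    (trans (funToFin-cong {m} {n} eq) (funToFin-finToFin {m} {n} d))

module Tripartite (k r : ℕ) where

  n : ℕ
  n = 3 * k + r

  -- nothing for the r isolated vertices.
  locate : Fin n → Maybe (Fin 3 × Fin k)
  locate v with splitAt (3 * k) v
  ... | inj₁ i = just (remQuot k i)
  ... | inj₂ _ = nothing

  vertex : Fin 3 → Fin k → Fin n
  vertex c i = combine c i ↑ˡ r

  locate-vertex : ∀ c i → locate (vertex c i) ≡ just (c , i)
  locate-vertex c i rewrite splitAt-↑ˡ (3 * k) (combine c i) r = cong just (remQuot-combine c i)

  colour : Maybe (Fin 3 × Fin k) → Fin 3
  colour (just (c , _)) = c
  colour nothing        = 0F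

  Edges : Set
  Edges = Fin 3 → Fin k → Fin k → Bool

  arc : Edges → Maybe (Fin 3 × Fin k) → Maybe (Fin 3 × Fin k) → Bool
  arc β (just (0F , i)) (just (1F , j)) = β 0F i j
  arc β (just (1F , i)) (just (2F , j)) = β 1F i j
  arc β (just (0F , i)) (just (2F , j)) = β 2F i j
  arc β _               _               = false

  arc-proper : ∀ β u v → T (arc β u v) → colour u ≢ colour v
  arc-proper β (just (0F , _)) (just (1F , _)) _ ()
  arc-proper β (just (1F , _)) (just (2F , _)) _ ()
  arc-proper β (just (0F , _)) (just (2F , _)) _ ()

  arc-irrefl : ∀ β u → arc β u u ≡ false
  arc-irrefl β (just (0F , _)) = refl
  arc-irrefl β (just (1F , _)) = refl
  arc-irrefl β (just (2F , _)) = refl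
  arc-irrefl β nothing         = refl

  tripartite : Edges → Graph n
  tripartite β = record
    { adj        = λ x y → arc β (locate x) (locate y) ∨ arc β (locate y) (locate x)
    ; adj-sym    = λ x y → ∨-comm (arc β (locate x) (locate y)) _
    ; adj-irrefl = λ x → cong₂ _∨_ (arc-irrefl β (locate x)) (arc-irrefl β (locate x))
    }

  tripartite-wr : ∀ β → WordRepresentable (tripartite β)
  tripartite-wr β = 3-colourable⇒wordRepresentable (tripartite β) (colour ∘ locate) proper
    where
    proper : ∀ {x y} → Adjacent (tripartite β) x y → colour (locate x) ≢ colour (locate y)
    proper {x} {y} e with Equivalence.to (T-∨ {arc β (locate x) (locate y)}) e
    ... | inj₁ e = arc-proper β (locate x) (locate y) e
    ... | inj₂ e = arc-proper β (locate y) (locate x) e ∘ sym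

  -- The three pairs of colours, numbered as in `arc`.
  source target : Fin 3 → Fin 3
  source 0F = 0F
  source 1F = 1F
  source 2F = 0F
  target 0F = 1F
  target 1F = 2F
  target 2F = 2F

  adj-vertex : ∀ β t i j → adj (tripartite β) (vertex (source t) i) (vertex (target t) j) ≡ β t i j
  adj-vertex β t i j rewrite locate-vertex (source t) i | locate-vertex (target t) j = arc-at t
    where
    arc-at : ∀ t → let u = just (source t , i); v = just (target t , j) in arc β u v ∨ arc β v u ≡ β t i j
    arc-at 0F = ∨-identityʳ (β 0F i j)
    arc-at 1F = ∨-identityʳ (β 1F i j)
    arc-at 2F = ∨-identityʳ (β 2F i j)

  private
    bit : Fin 2 → Bool
    bit b = does (b ≟ 1F)

    bit-injective : ∀ b b′ → bit b ≡ bit b′ → b ≡ b′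
    bit-injective 0F 0F _ = refl
    bit-injective 1F 1F _ = refl
    bit-injective 0F 1F ()
    bit-injective 1F 0F ()

  edges : Fin (((2 ^ k) ^ k) ^ 3) → Edges
  edges c t i j = bit (finToFun {2} {k} (finToFun {2 ^ k} {k} (finToFun {(2 ^ k) ^ k} {3} c t) i) j)

  edges-injective : ∀ {c d} → (∀ t i j → edges c t i j ≡ edges d t i j) → c ≡ d
  edges-injective eq =
    finToFun-injective 3 ((2 ^ k) ^ k) λ t → finToFun-injective k (2 ^ k) λ i →
    finToFun-injective k 2 λ j → bit-injective _ _ (eq t i j)

  -- A labelled graph is recovered from its class and a relabelling, by pulling the representative
  -- back along the isomorphism; there are at most `n ^ n` relabellings.
  tripartite≤classes : ∀ {a} → HasCardinality (WordRepresentableGraphs n) a → ((2 ^ k) ^ k) ^ 3 ≤ a * n ^ n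
  tripartite≤classes {a} card = injective⇒≤ {f = place} λ {c} {d} → place-injective c d
    where
    open Bijection card using (to; surjective)
    graphOf : Fin (((2 ^ k) ^ k) ^ 3) → Graph n
    graphOf c = tripartite (edges c)
    class : Fin (((2 ^ k) ^ k) ^ 3) → Fin a
    class c = proj₁ (surjective (graphOf c , tripartite-wr (edges c)))
    iso : ∀ c → graphOf c ≅ proj₁ (to (class c))
    iso c = ≅-sym {G = proj₁ (to (class c))} {graphOf c}
      (proj₂ (surjective (graphOf c , tripartite-wr (edges c))) refl)
    relabel : ∀ c → Fin n → Fin n
    relabel c = proj₁ (iso c) ⟨$⟩ʳ_
    place : Fin (((2 ^ k) ^ k) ^ 3) → Fin (a * n ^ n)
    place c = combine (class c) (funToFin (relabel c))
    place-injective : ∀ c d → place c ≡ place d → c ≡ d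
    place-injective c d eq = edges-injective λ t i j → begin
      edges c t i j
        ≡⟨ adj-vertex (edges c) t i j ⟨
      adj (graphOf c) (u t i) (v t j)
        ≡⟨ proj₂ (iso c) (u t i) (v t j) ⟨
      adj (rep c) (relabel c (u t i)) (relabel c (v t j))
        ≡⟨ cong₂ (adj (rep c)) (same (u t i)) (same (v t j)) ⟩
      adj (rep c) (relabel d (u t i)) (relabel d (v t j))
        ≡⟨ cong (λ z → adj (proj₁ (to z)) (relabel d (u t i)) (relabel d (v t j))) (proj₁ eqs) ⟩
      adj (rep d) (relabel d (u t i)) (relabel d (v t j))
        ≡⟨ proj₂ (iso d) (u t i) (v t j) ⟩
      adj (graphOf d) (u t i) (v t j)
        ≡⟨ adj-vertex (edges d) t i j ⟩
      edges d t i j ∎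
      where
      open ≡-Reasoning
      rep = λ c → proj₁ (to (class c))
      u = λ t → vertex (source t)
      v = λ t → vertex (target t)
      eqs : class c ≡ class d × funToFin (relabel c) ≡ funToFin (relabel d)
      eqs = combine-injective (class c) (funToFin (relabel c)) (class d) (funToFin (relabel d)) eq
      same : ∀ x → relabel c x ≡ relabel d x
      same x = trans (sym (finToFun-funToFin (relabel c) x))
        (trans (cong (λ z → finToFun z x) (proj₂ eqs)) (finToFun-funToFin (relabel d) x))

-- Asymptotics

floor-sqrt : ∀ n → ∃[ m ] m * m ≤ n × n < suc m * suc m
floor-sqrt zero    = 0 , z≤n , s≤s z≤n
floor-sqrt (suc n) with m , lo , hi ← floor-sqrt n with suc m * suc m ℕ.≤? suc n
... | no  hi′ = m , ℕ.m≤n⇒m≤1+n lo , ℕ.≰⇒> hi′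
... | yes lo′ = suc m , lo′ , ℕ.≤-<-trans hi (ℕ.*-mono-< (ℕ.n<1+n (suc m)) (ℕ.n<1+n (suc m)))

n<2^n : ∀ n → n < 2 ^ n
n<2^n zero    = s≤s z≤n
n<2^n (suc n) = begin-strict
  suc n              <⟨ s≤s (n<2^n n) ⟩
  suc (2 ^ n)        ≤⟨ ℕ.+-monoˡ-≤ (2 ^ n) (ℕ.m^n>0 2 n) ⟩
  2 ^ n + 2 ^ n      ≡⟨ cong (2 ^ n +_) (ℕ.+-identityʳ (2 ^ n)) ⟨
  2 ^ suc n          ∎
  where open ℕ.≤-Reasoning

-- With m the integer square root of `n`, both m + 1 ≤ 2 ^ m and 2 c ≤ m hold, so `n ^ c` is at most
-- 2 ^ (2 m c) ≤ 2 ^ (m m).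
polynomial≤exponential : ∀ c n → (2 * c) * (2 * c) ≤ n → n ^ c ≤ 2 ^ n
polynomial≤exponential c n large with m , lo , hi ← floor-sqrt n = begin
  n ^ c                    ≤⟨ ℕ.^-monoˡ-≤ c (ℕ.<⇒≤ hi) ⟩
  (suc m * suc m) ^ c      ≤⟨ ℕ.^-monoˡ-≤ c (ℕ.*-mono-≤ (n<2^n m) (n<2^n m)) ⟩
  (2 ^ m * 2 ^ m) ^ c      ≡⟨ cong (_^ c) (ℕ.^-distribˡ-+-* 2 m m) ⟨
  (2 ^ (m + m)) ^ c        ≡⟨ ℕ.^-*-assoc 2 (m + m) c ⟩
  2 ^ ((m + m) * c)        ≡⟨ cong (2 ^_) (eq m c) ⟩
  2 ^ (m * (2 * c))        ≤⟨ ℕ.^-monoʳ-≤ 2 (ℕ.*-monoʳ-≤ m 2c≤m) ⟩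
  2 ^ (m * m)              ≤⟨ ℕ.^-monoʳ-≤ 2 lo ⟩
  2 ^ n                    ∎
  where
  open ℕ.≤-Reasoning
  eq : ∀ m c → (m + m) * c ≡ m * (2 * c)
  eq = solve-∀
  2c≤m : 2 * c ≤ m
  2c≤m = ℕ.≮⇒≥ λ m<2c → ℕ.<-irrefl refl (ℕ.<-≤-trans hi (ℕ.≤-trans (ℕ.*-mono-≤ m<2c m<2c) large))

tripartite-count : ∀ k → 2 ^ (3 * (k * k)) ≡ ((2 ^ k) ^ k) ^ 3
tripartite-count k = sym (trans (cong (_^ 3) (ℕ.^-*-assoc 2 k k))
  (trans (ℕ.^-*-assoc 2 (k * k) 3) (cong (2 ^_) (ℕ.*-comm (k * k) 3))))

thirds : ∀ n → ∃[ k ] ∃[ r ] n ≡ 3 * k + r × r ≤ 2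
thirds n = n / 3 , n % 3 , trans (m≡m%n+[m/n]*n n 3) (eq (n % 3) (n / 3)) , s≤s⁻¹ (m%n<n n 3)
  where
  eq : ∀ r k → r + k * 3 ≡ 3 * k + r
  eq = solve-∀

-- The `r` leftover vertices change the square only by a linear term.
square≤ : ∀ k r → r ≤ 2 → (3 * k + r) ^ 2 ≤ 9 * (k * k) + 4 * suc (3 * k + r)
square≤ k r r≤2 = begin
  (3 * k + r) ^ 2
    ≡⟨ eq₁ k r ⟩
  9 * (k * k) + (2 * (3 * k) * r + r * r)
    ≤⟨ ℕ.+-monoʳ-≤ (9 * (k * k)) (ℕ.+-mono-≤ (ℕ.*-monoʳ-≤ (2 * (3 * k)) r≤2) (ℕ.*-mono-≤ r≤2 r≤2)) ⟩
  9 * (k * k) + (2 * (3 * k) * 2 + 4)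
    ≤⟨ ℕ.m≤m+n _ (4 * r) ⟩
  9 * (k * k) + (2 * (3 * k) * 2 + 4) + 4 * r
    ≡⟨ eq₂ k r ⟩
  9 * (k * k) + 4 * suc (3 * k + r) ∎
  where
  open ℕ.≤-Reasoning
  eq₁ : ∀ k r → (3 * k + r) * ((3 * k + r) * 1) ≡ 9 * (k * k) + (2 * (3 * k) * r + r * r)
  eq₁ = solve-∀
  eq₂ : ∀ k r → 9 * (k * k) + (2 * (3 * k) * 2 + 4) + 4 * r ≡ 9 * (k * k) + 4 * suc (3 * k + r)
  eq₂ = solve-∀

module _ (p q : ℕ) .{{_ : NonZero p}} .{{_ : NonZero q}} where

  -- The `11 * q` collects `3 * q` from the relabellings `n ^ n` and `8 * q` from the linear error
  -- in `n ^ 2`, where 2 is replaced by `n`.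
  lower-bound : ∀ a n k → 2 ≤ n → n ^ (11 * q) ≤ 2 ^ n → n ^ 2 ≤ 9 * (k * k) + 4 * suc n →
                2 ^ (3 * (k * k)) ≤ a * n ^ n → 2 ^ (q * n ^ 2) ≤ a ^ (3 * q) * 2 ^ (3 * p * n ^ 2)
  lower-bound a n k 2≤n n^11q≤ n²≤ labelled≤ = begin
    2 ^ (q * n ^ 2)
      ≤⟨ ℕ.^-monoʳ-≤ 2 exponent ⟩
    2 ^ (3 * (k * k) * (3 * q) + 8 * q * n)
      ≡⟨ trans (ℕ.^-distribˡ-+-* 2 (3 * (k * k) * (3 * q)) (8 * q * n))
           (cong₂ _*_ (sym (ℕ.^-*-assoc 2 (3 * (k * k)) (3 * q))) (sym (ℕ.^-*-assoc 2 (8 * q) n))) ⟩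
    (2 ^ (3 * (k * k))) ^ (3 * q) * (2 ^ (8 * q)) ^ n
      ≤⟨ ℕ.*-mono-≤ (ℕ.^-monoˡ-≤ (3 * q) labelled≤) (ℕ.^-monoˡ-≤ n (ℕ.^-monoˡ-≤ (8 * q) 2≤n)) ⟩
    (a * n ^ n) ^ (3 * q) * (n ^ (8 * q)) ^ n
      ≡⟨ cong₂ _*_ (trans (^-distribʳ-* a (n ^ n) (3 * q)) (cong (a ^ (3 * q) *_) (ℕ.^-*-assoc n n (3 * q))))
                   (ℕ.^-*-assoc n (8 * q) n) ⟩
    a ^ (3 * q) * n ^ (n * (3 * q)) * n ^ (8 * q * n)
      ≡⟨ trans (ℕ.*-assoc (a ^ (3 * q)) _ _) (cong (a ^ (3 * q) *_)
           (trans (sym (ℕ.^-distribˡ-+-* n (n * (3 * q)) (8 * q * n)))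
             (trans (cong (n ^_) (eq₂ q n)) (sym (ℕ.^-*-assoc n (11 * q) n))))) ⟩
    a ^ (3 * q) * (n ^ (11 * q)) ^ n
      ≤⟨ ℕ.*-monoʳ-≤ (a ^ (3 * q)) (ℕ.^-monoˡ-≤ n n^11q≤) ⟩
    a ^ (3 * q) * (2 ^ n) ^ n
      ≡⟨ cong (a ^ (3 * q) *_) (trans (ℕ.^-*-assoc 2 n n) (cong (λ z → 2 ^ (n * z)) (sym (ℕ.*-identityʳ n)))) ⟩
    a ^ (3 * q) * 2 ^ (n ^ 2)
      ≤⟨ ℕ.*-monoʳ-≤ (a ^ (3 * q)) (ℕ.^-monoʳ-≤ 2 (ℕ.m≤n*m (n ^ 2) (3 * p) {{ℕ.m*n≢0 3 p}})) ⟩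
    a ^ (3 * q) * 2 ^ (3 * p * n ^ 2) ∎
    where
    open ℕ.≤-Reasoning
    1+n≤2n : suc n ≤ 2 * n
    1+n≤2n = ℕ.≤-trans (ℕ.+-monoˡ-≤ n (ℕ.≤-trans (s≤s z≤n) 2≤n))
      (ℕ.≤-reflexive (cong (n +_) (sym (ℕ.+-identityʳ n))))
    eq₁ : ∀ q k n → q * (9 * (k * k) + 4 * (2 * n)) ≡ 3 * (k * k) * (3 * q) + 8 * q * n
    eq₁ = solve-∀
    eq₂ : ∀ q n → n * (3 * q) + 8 * q * n ≡ 11 * q * n
    eq₂ = solve-∀
    exponent : q * n ^ 2 ≤ 3 * (k * k) * (3 * q) + 8 * q * n
    exponent = begin
      q * n ^ 2
        ≤⟨ ℕ.*-monoʳ-≤ q (ℕ.≤-trans n²≤ (ℕ.+-monoʳ-≤ (9 * (k * k)) (ℕ.*-monoʳ-≤ 4 1+n≤2n))) ⟩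
      q * (9 * (k * k) + 4 * (2 * n))
        ≡⟨ eq₁ q k n ⟩
      3 * (k * k) * (3 * q) + 8 * q * n ∎

  -- Once `n` exceeds `B + C`, the linear terms are at most `n * n`, hence within the slack
  -- `p * (n * n)`.
  upper-bound : Bounded (3 * q) (q + 2 * p) (λ G _ → ShortcutFree G) →
                ∃[ N ] ∀ n a → N ≤ n → HasCardinality (WordRepresentableGraphs n) a →
                a ^ (3 * q) ≤ 2 ^ (q * n ^ 2 + 3 * p * n ^ 2)
  upper-bound (B , C , bounded) = suc (B + C) , bound
    where
    bound : ∀ n a → suc (B + C) ≤ n → HasCardinality (WordRepresentableGraphs n) a →
            a ^ (3 * q) ≤ 2 ^ (q * n ^ 2 + 3 * p * n ^ 2)
    bound n a large card = let xs , xs≤ , coded = bounded n in begin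
      a ^ (3 * q)                                       ≤⟨ ℕ.^-monoˡ-≤ (3 * q) (classes≤ card coded) ⟩
      length xs ^ (3 * q)                               ≤⟨ xs≤ ⟩
      2 ^ ((q + 2 * p) * (n * n) + B * n + C)           ≤⟨ ℕ.^-monoʳ-≤ 2 exponent ⟩
      2 ^ (q * n ^ 2 + 3 * p * n ^ 2)                   ∎
      where
      open ℕ.≤-Reasoning
      eq : ∀ p q n → (q + 2 * p) * (n * n) + p * (n * n) ≡ q * (n * (n * 1)) + 3 * p * (n * (n * 1))
      eq = solve-∀
      exponent : (q + 2 * p) * (n * n) + B * n + C ≤ q * n ^ 2 + 3 * p * n ^ 2
      exponent = begin
        (q + 2 * p) * (n * n) + B * n + C         ≡⟨ ℕ.+-assoc ((q + 2 * p) * (n * n)) (B * n) C ⟩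
        (q + 2 * p) * (n * n) + (B * n + C)       ≤⟨ ℕ.+-monoʳ-≤ ((q + 2 * p) * (n * n)) (begin
          B * n + C        ≤⟨ ℕ.+-monoʳ-≤ (B * n) (ℕ.m≤m*n C n {{>-nonZero (ℕ.≤-trans (s≤s z≤n) large)}}) ⟩
          B * n + C * n    ≡⟨ ℕ.*-distribʳ-+ n B C ⟨
          (B + C) * n      ≤⟨ ℕ.*-monoˡ-≤ n (ℕ.<⇒≤ large) ⟩
          n * n            ≤⟨ ℕ.m≤n*m (n * n) p ⟩
          p * (n * n)      ∎) ⟩
        (q + 2 * p) * (n * n) + p * (n * n)       ≡⟨ eq p q n ⟩
        q * n ^ 2 + 3 * p * n ^ 2                 ∎

corollary1 : #wordRepresentable ≐2^[ (λ n → n ^ 2) / 3 +o (λ n → n ^ 2) ]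
corollary1 p q = L + U , λ n L+U≤n →
  lower n (#wordRepresentable n) (ℕ.m+n≤o⇒m≤o L L+U≤n) (proj₂ (numberOfClasses n)) ,
  proj₂ upper n (#wordRepresentable n) (ℕ.m+n≤o⇒n≤o L L+U≤n) (proj₂ (numberOfClasses n))
  where
  -- `S` is the threshold of `polynomial≤exponential` for the exponent `11 * q`; the 2 added in `L`
  -- provides `2 ≤ n`.
  S = 2 * (11 * q) * (2 * (11 * q))
  L = 2 + S
  upper = upper-bound p q (bounded-shortcutFree p q)
  U = proj₁ upper
  lower : ∀ n a → L ≤ n → HasCardinality (WordRepresentableGraphs n) a →
          2 ^ (q * n ^ 2) ≤ a ^ (3 * q) * 2 ^ (3 * p * n ^ 2)
  lower n a large card with k , r , refl , r≤2 ← thirds n =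
    lower-bound p q a n k (ℕ.m+n≤o⇒m≤o 2 large) (polynomial≤exponential (11 * q) n (ℕ.m+n≤o⇒n≤o 2 large))
      (square≤ k r r≤2) (subst (_≤ a * n ^ n) (sym (tripartite-count k)) (Tripartite.tripartite≤classes k r card))
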